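{- Let $\lambda$ be a fixed partition of $n$, let $f:\mathbb{N}\to\mathbb{R}$ be an arbitrary function, and let $E_\lambda[d_f]$ be the expected value of the descent function $d_f$ on a uniformly random standard Young tableau of shape $\lambda$. Then $$E_\lambda[d_f]=c(\lambda)\cdot\sum_{i=1}^{n-1} f(i),$$ where $$c(\lambda):=\frac{\binom{n}{2}-\sum_i\binom{\lambda_i}{2}+\sum_j\binom{\lambda'_j}{2}}{n(n-1)}.$$
   Context: For a partition $\lambda=(\lambda_1\ge\lambda_2\ge\dots\ge\lambda_k)$ of $n$, $\lambda_i$ is the length of the $i$-th row of the Young diagram of shape $\lambda$ and $\lambda'_j$ is the length of its $j$-th column (so $\lambda'$ is the conjugate partition). Diagrams are drawn in English convention (row 1 on top). A standard Young tableau of shape $\lambda$ is a filling of the diagram with $1,\dots,n$, each used once, increasing along rows (left to right) and columns (top to bottom). A descent in a standard Young tableau $T$ is an entry $i$ (with $1\le i\le n-1$) such that $i+1$ lies strictly south (and weakly west) of $i$, equivalently, $i+1$ is in a strictly lower row (larger row index) than $i$; $D(T)$ is the set of descents of $T$. For $f:\mathbb{N}\to\mathbb{R}$, the descent function is $d_f(T):=\sum_{i\in D(T)} f(i)$. Random tableaux of shape $\lambda$ are chosen uniformly among all standard Young tableaux of shape $\lambda$. -}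

module Defs where

open import Data.Fin.Base as Fin using (Fin; toℕ)
import Data.Fin.Properties as Fin
open import Data.Integer.Base as ℤ using (+_)
open import Data.List.Base
  using (List; []; _∷_; length; lookup; map; foldr; filter; upTo;
         applyUpTo; allFin; cartesianProductWith)
open import Data.List.Membership.Propositional.Properties using (∈-lookup)
open import Data.List.Relation.Unary.All as All using (All; []; _∷_)
open import Data.List.Relation.Unary.Linked using (Linked)
open import Data.Nat.Base as ℕ using (ℕ; zero; suc; _∸_)
open import Data.Nat.Combinatorics using (_C_)
open import Data.Nat.ListAction using (sum)
import Data.Nat.Properties as ℕ
open import Data.Product.Base using (_×_; _,_; ∃; ∃₂; proj₁; proj₂)
import Data.Product.Properties as Product
open import Data.Rational.Base as ℚ using (ℚ; 0ℚ; 1ℚ; ½)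
import Data.Rational.Properties as ℚ
open import Data.Vec.Base as Vec using (Vec; []; _∷_)
open import Function.Definitions using (Bijective)
open import Relation.Binary.Definitions using (DecidableEquality)
open import Relation.Binary.PropositionalEquality
  using (_≡_; refl; sym; trans; cong; subst)
open import Relation.Nullary.Decidable using (Dec; map′; _×-dec_; _→-dec_)
open import Relation.Unary using (Pred; Decidable)

-- Real numbers as Cauchy sequences of rationals; the equality is _≈_.
record ℝ : Set where
  constructor mkℝ
  field
    seq    : ℕ → ℚ
    cauchy : ∀ ε → 0ℚ ℚ.< ε →
             ∃ λ N → ∀ k l → N ℕ.≤ k → N ℕ.≤ l →
             ℚ.∣ seq k ℚ.- seq l ∣ ℚ.< ε

open ℝ public

infix  4 _≈_
infixl 6 _+_
infixr 7 _·_

_≈_ : ℝ → ℝ → Set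
x ≈ y = ∀ ε → 0ℚ ℚ.< ε →
        ∃ λ N → ∀ k → N ℕ.≤ k → ℚ.∣ seq x k ℚ.- seq y k ∣ ℚ.< ε

0ℝ : ℝ
0ℝ = mkℝ (λ _ → 0ℚ) (λ _ 0<ε → 0 , λ _ _ _ _ → 0<ε)

_+_ : ℝ → ℝ → ℝ
x + y = mkℝ (λ k → seq x k ℚ.+ seq y k) +-cauchy
  where
  open import Data.Rational.Solver using (module +-*-Solver)
  open +-*-Solver using (solve; _:=_; _:+_; _:-_)

  rearrange : ∀ a b c d →
              (a ℚ.+ b) ℚ.- (c ℚ.+ d) ≡ (a ℚ.- c) ℚ.+ (b ℚ.- d)
  rearrange = solve 4 (λ a b c d →
    (a :+ b) :- (c :+ d) := (a :- c) :+ (b :- d)) refl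

  halves : ∀ ε → ½ ℚ.* ε ℚ.+ ½ ℚ.* ε ≡ ε
  halves ε = trans (sym (ℚ.*-distribʳ-+ ε ½ ½)) (ℚ.*-identityˡ ε)

  +-cauchy : ∀ ε → 0ℚ ℚ.< ε →
             ∃ λ N → ∀ k l → N ℕ.≤ k → N ℕ.≤ l →
             ℚ.∣ (seq x k ℚ.+ seq y k) ℚ.- (seq x l ℚ.+ seq y l) ∣ ℚ.< ε
  +-cauchy ε 0<ε = M ℕ.⊔ N , λ k l p q → begin-strict
      ℚ.∣ (seq x k ℚ.+ seq y k) ℚ.- (seq x l ℚ.+ seq y l) ∣
        ≡⟨ cong ℚ.∣_∣ (rearrange (seq x k) (seq y k) (seq x l) (seq y l)) ⟩
      ℚ.∣ (seq x k ℚ.- seq x l) ℚ.+ (seq y k ℚ.- seq y l) ∣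
        ≤⟨ ℚ.∣p+q∣≤∣p∣+∣q∣ (seq x k ℚ.- seq x l) (seq y k ℚ.- seq y l) ⟩
      ℚ.∣ seq x k ℚ.- seq x l ∣ ℚ.+ ℚ.∣ seq y k ℚ.- seq y l ∣
        <⟨ ℚ.+-mono-<
             (proj₂ cx k l (ℕ.m⊔n≤o⇒m≤o M N p) (ℕ.m⊔n≤o⇒m≤o M N q))
             (proj₂ cy k l (ℕ.m⊔n≤o⇒n≤o M N p) (ℕ.m⊔n≤o⇒n≤o M N q)) ⟩
      ½ ℚ.* ε ℚ.+ ½ ℚ.* ε
        ≡⟨ halves ε ⟩
      ε ∎
    where
    open ℚ.≤-Reasoning
    0<½ε : 0ℚ ℚ.< ½ ℚ.* ε
    0<½ε = subst (ℚ._< ½ ℚ.* ε) (ℚ.*-zeroʳ ½) (ℚ.*-monoʳ-<-pos ½ 0<ε)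
    cx = cauchy x (½ ℚ.* ε) 0<½ε
    cy = cauchy y (½ ℚ.* ε) 0<½ε
    M = proj₁ cx
    N = proj₁ cy

_·_ : ℚ → ℝ → ℝ
q · x = mkℝ (λ k → q ℚ.* seq x k) ·-cauchy
  where
  B : ℚ
  B = ℚ.∣ q ∣ ℚ.+ 1ℚ

  instance
    B-pos : ℚ.Positive B
    B-pos = ℚ.nonNeg+pos⇒pos ℚ.∣ q ∣ {{ℚ.∣-∣-nonNeg q}} 1ℚ

    B-nonZero : ℚ.NonZero B
    B-nonZero = ℚ.pos⇒nonZero B

    1/B-pos : ℚ.Positive (ℚ.1/ B)
    1/B-pos = ℚ.1/pos⇒pos B

  ∣q∣≤B : ℚ.∣ q ∣ ℚ.≤ B
  ∣q∣≤B = subst (ℚ._≤ B) (ℚ.+-identityʳ ℚ.∣ q ∣)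
            (ℚ.+-monoʳ-≤ ℚ.∣ q ∣ (ℚ.nonNegative⁻¹ 1ℚ))

  ·-cauchy : ∀ ε → 0ℚ ℚ.< ε →
             ∃ λ N → ∀ k l → N ℕ.≤ k → N ℕ.≤ l →
             ℚ.∣ q ℚ.* seq x k ℚ.- q ℚ.* seq x l ∣ ℚ.< ε
  ·-cauchy ε 0<ε = proj₁ cx , λ k l N≤k N≤l →
    let d = seq x k ℚ.- seq x l in begin-strict
      ℚ.∣ q ℚ.* seq x k ℚ.- q ℚ.* seq x l ∣
        ≡⟨ cong (λ z → ℚ.∣ q ℚ.* seq x k ℚ.+ z ∣) (ℚ.neg-distribʳ-* q (seq x l)) ⟩
      ℚ.∣ q ℚ.* seq x k ℚ.+ q ℚ.* ℚ.- seq x l ∣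
        ≡⟨ cong ℚ.∣_∣ (ℚ.*-distribˡ-+ q (seq x k) (ℚ.- seq x l)) ⟨
      ℚ.∣ q ℚ.* d ∣
        ≡⟨ ℚ.∣p*q∣≡∣p∣*∣q∣ q d ⟩
      ℚ.∣ q ∣ ℚ.* ℚ.∣ d ∣
        ≤⟨ ℚ.*-monoʳ-≤-nonNeg ℚ.∣ d ∣ {{ℚ.∣-∣-nonNeg d}} ∣q∣≤B ⟩
      B ℚ.* ℚ.∣ d ∣
        <⟨ ℚ.*-monoʳ-<-pos B (proj₂ cx k l N≤k N≤l) ⟩
      B ℚ.* (ℚ.1/ B ℚ.* ε)
        ≡⟨ ℚ.*-assoc B (ℚ.1/ B) ε ⟨
      (B ℚ.* ℚ.1/ B) ℚ.* ε
        ≡⟨ cong (ℚ._* ε) (ℚ.*-inverseʳ B) ⟩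
      1ℚ ℚ.* ε
        ≡⟨ ℚ.*-identityˡ ε ⟩
      ε ∎
    where
    open ℚ.≤-Reasoning
    0<ε/B : 0ℚ ℚ.< ℚ.1/ B ℚ.* ε
    0<ε/B = subst (ℚ._< ℚ.1/ B ℚ.* ε) (ℚ.*-zeroʳ (ℚ.1/ B))
              (ℚ.*-monoʳ-<-pos (ℚ.1/ B) 0<ε)
    cx = cauchy x (ℚ.1/ B ℚ.* ε) 0<ε/B

sumℝ : List ℝ → ℝ
sumℝ = foldr _+_ 0ℝ

-- The value at [] is a dummy: every partition has a standard tableau.
mean : List ℝ → ℝ
mean []          = 0ℝ
mean xs@(_ ∷ _) = (+ 1 ℚ./ length xs) · sumℝ xs

record Partition (n : ℕ) : Set where
  field
    parts      : List ℕ
    decreasing : Linked ℕ._≥_ parts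
    positive   : All (ℕ._> 0) parts
    total      : sum parts ≡ n

open Partition public

largest : List ℕ → ℕ
largest = foldr ℕ._⊔_ 0

-- Columns are numbered from 0, so column j has as many cells as there
-- are rows of length > j.
conjugate : List ℕ → List ℕ
conjugate ps = map (λ j → length (filter (j ℕ.<?_) ps)) (upTo (largest ps))

-- The cells of the diagram with rows of the given lengths, numbered from 0.
record Cell (ps : List ℕ) : Set where
  constructor cell
  field
    rowIx : Fin (length ps)
    colIx : Fin (lookup ps rowIx)

  row col : ℕ
  row = toℕ rowIx
  col = toℕ colIx

open Cell public

module _ {ps : List ℕ} where

  _≟ᶜ_ : DecidableEquality (Cell ps)
  cell i j ≟ᶜ cell i′ j′ = map′ (λ { refl → refl }) (λ { refl → refl })
    (Product.≡-dec Fin._≟_ Fin._≟_ (i , j) (i′ , j′))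

  allCells? : ∀ {p} {P : Pred (Cell ps) p} → Decidable P → Dec (∀ c → P c)
  allCells? P? = map′ (λ h (cell i j) → h i j) (λ h i j → h (cell i j))
    (Fin.all? λ i → Fin.all? λ j → P? (cell i j))

  anyCell? : ∀ {p} {P : Pred (Cell ps) p} → Decidable P → Dec (∃ P)
  anyCell? P? =
    map′ (λ (i , j , p) → cell i j , p) (λ (cell i j , p) → i , j , p)
    (Fin.any? λ i → Fin.any? λ j → P? (cell i j))

-- One vector of entries per row; k : Fin n stands for the number toℕ k + 1.
Filling : ℕ → List ℕ → Set
Filling n ps = All (Vec (Fin n)) ps

module _ {n : ℕ} {ps : List ℕ} where

  entry : Filling n ps → Cell ps → Fin n
  entry T (cell i j) = Vec.lookup (All.lookup T (∈-lookup i)) j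

  label : Filling n ps → Cell ps → ℕ
  label T c = suc (toℕ (entry T c))

  record IsStandard (T : Filling n ps) : Set where
    field
      eachOnce    : Bijective _≡_ _≡_ (entry T)
      increasing→ : ∀ c d → row c ≡ row d → col c ℕ.< col d →
                    label T c ℕ.< label T d
      increasing↓ : ∀ c d → col c ≡ col d → row c ℕ.< row d →
                    label T c ℕ.< label T d

  isStandard? : Decidable IsStandard
  isStandard? T = map′
    (λ (inj , surj , incr→ , incr↓) → record
      { eachOnce    = (λ {x} {y} → inj x y) ,
                      (λ y → proj₁ (surj y) , λ { refl → proj₂ (surj y) })
      ; increasing→ = incr→
      ; increasing↓ = incr↓
      })
    (λ s → let open IsStandard s in
      (λ x y → proj₁ eachOnce {x} {y}) ,
      (λ y → proj₁ (proj₂ eachOnce y) , proj₂ (proj₂ eachOnce y) refl) ,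
      increasing→ , increasing↓)
    ((allCells? λ c → allCells? λ d →
        (entry T c Fin.≟ entry T d) →-dec (c ≟ᶜ d)) ×-dec
     (Fin.all? λ k → anyCell? λ c → entry T c Fin.≟ k) ×-dec
     (allCells? λ c → allCells? λ d →
        (row c ℕ.≟ row d) →-dec (col c ℕ.<? col d) →-dec
        (label T c ℕ.<? label T d)) ×-dec
     (allCells? λ c → allCells? λ d →
        (col c ℕ.≟ col d) →-dec (row c ℕ.<? row d) →-dec
        (label T c ℕ.<? label T d)))

allVecs : ∀ {A : Set} → List A → ∀ k → List (Vec A k)
allVecs xs zero    = [] ∷ []
allVecs xs (suc k) = cartesianProductWith _∷_ xs (allVecs xs k)

allFillings : ∀ {A : Set} → List A → (ps : List ℕ) → List (All (Vec A) ps)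
allFillings xs []       = [] ∷ []
allFillings xs (p ∷ ps) =
  cartesianProductWith _∷_ (allVecs xs p) (allFillings xs ps)

standardTableaux : ∀ {n} (Λ : Partition n) → List (Filling n (parts Λ))
standardTableaux {n} Λ = filter isStandard? (allFillings (allFin n) (parts Λ))

[1‥_] : ℕ → List ℕ
[1‥ n ] = applyUpTo suc n

module _ {n : ℕ} {ps : List ℕ} where

  IsDescent : Filling n ps → ℕ → Set
  IsDescent T i = ∃₂ λ c d →
    label T c ≡ i × label T d ≡ suc i × row c ℕ.< row d

  isDescent? : ∀ T → Decidable (IsDescent T)
  isDescent? T i = anyCell? λ c → anyCell? λ d →
    (label T c ℕ.≟ i) ×-dec (label T d ℕ.≟ suc i) ×-dec (row c ℕ.<? row d)

  descents : Filling n ps → List ℕ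
  descents T = filter (isDescent? T) [1‥ n ∸ 1 ]

  descentFunction : (ℕ → ℝ) → Filling n ps → ℝ
  descentFunction f T = sumℝ (map f (descents T))

expectation : ∀ {n} (Λ : Partition n) → (Filling n (parts Λ) → ℝ) → ℝ
expectation Λ g = mean (map g (standardTableaux Λ))

n[n∸1]-nonZero : ∀ n → .{{ℕ.NonTrivial n}} → ℕ.NonZero (n ℕ.* (n ∸ 1))
n[n∸1]-nonZero (suc (suc n)) = _

coefficient : ∀ {n} .{{_ : ℕ.NonTrivial n}} → Partition n → ℚ
coefficient {n} Λ =
  ((+ (n C 2) ℤ.- + sum (map (_C 2) (parts Λ)))
    ℤ.+ + sum (map (_C 2) (conjugate (parts Λ))))
  ℚ./ (n ℕ.* (n ∸ 1))
  where instance _ = n[n∸1]-nonZero n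

{-# OPTIONS --safe #-}

-- The proof follows the content c_k of the cell holding k through the sum over
-- all standard tableaux. Exchanging k and k + 1 is an involution on the
-- tableaux in which they are not adjacent, and descents are read off contents:
-- k is a descent iff c_{k+1} < c_k. Pairing tableaux under this exchange shows
--   Σ_T (c_{k+1} - c_k) = #tableaux - 2 #(tableaux with descent k),
-- because adjacent k, k + 1 contribute exactly ±1 to both sides. Pairing under
-- the exchanges of k, k + 1 and of k + 1, k + 2 shows that the number Δ of
-- tableaux with descent k does not depend on k. Hence Σ_T c_k is linear in k,
-- and summing over k, where Σ_k c_k is the total content of the diagram,
-- determines Δ.
module Submission where

open import Defs
open import Data.Nat.Base using (ℕ; NonTrivial; _∸_)
open import Data.List.Base using (map)

open import Algebra.Bundles using (CommutativeMonoid; CommutativeRing)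
open import Data.Bool.Base using (true; false; if_then_else_)
open import Data.Empty using (⊥)
open import Data.Fin.Base as Fin using (Fin; zero; suc; toℕ; fromℕ<; inject₁; _↑ˡ_; _↑ʳ_; splitAt)
open import Data.Fin.Induction using (<-weakInduction)
open import Data.Fin.Permutation.Components using (transpose)
import Data.Fin.Properties as Fin
open import Data.Integer.Base as ℤ using (ℤ; +_; 0ℤ; 1ℤ)
import Data.Integer.Properties as ℤ
open import Data.Integer.Tactic.RingSolver using (solve-∀)
open import Data.List.Base
  using (List; []; _∷_; _++_; foldr; filter; length; lookup; allFin; applyUpTo; upTo)
open import Data.List.Membership.Propositional using (_∈_)
open import Data.List.Membership.Propositional.Properties
open import Data.List.Membership.Propositional.Properties.WithK using (unique∧set⇒bag)
open import Data.List.Properties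
  using (map-tabulate; length-tabulate; length-++; length-map; map-upTo;
         filter-none; filter-accept; filter-reject)
open import Data.List.Relation.Binary.BagAndSetEquality using (∼bag⇒↭)
open import Data.List.Relation.Binary.Permutation.Propositional as ↭ using (_↭_)
open import Data.List.Relation.Unary.All as All using (All; []; _∷_)
import Data.List.Relation.Unary.All.Properties as All
open import Data.List.Relation.Unary.AllPairs using (AllPairs; []; _∷_)
open import Data.List.Relation.Unary.Any using (here; there)
open import Data.List.Relation.Unary.Linked using (Linked)
open import Data.List.Relation.Unary.Linked.Properties using (Linked⇒AllPairs)
open import Data.List.Relation.Unary.Unique.Propositional using (Unique)
import Data.List.Relation.Unary.Unique.Propositional.Properties as Unique
open import Data.Nat.Base as ℕ using (zero; suc)
open import Data.Nat.Combinatorics using (_C_; nC1≡n; nCk+nC[k+1]≡[n+1]C[k+1])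
open import Data.Nat.ListAction using (sum)
import Data.Nat.Properties as ℕ
open import Data.Nat.Tactic.RingSolver using () renaming (solve-∀ to ℕ-solve-∀)
open import Data.Product.Base using (_×_; _,_; ∃; proj₁; proj₂)
open import Data.Rational.Base as ℚ using (ℚ; 0ℚ)
import Data.Rational.Properties as ℚ
import Data.Rational.Unnormalised.Base as ℚᵘ
import Data.Rational.Unnormalised.Properties as ℚᵘ
open import Data.Sum.Base using (_⊎_; inj₁; inj₂)
open import Data.Vec.Base as Vec using (Vec; []; _∷_)
import Data.Vec.Properties as Vec
open import Function.Base using (_∘_; case_of_)
open import Function.Bundles using (mk⇔)
open import Level using (0ℓ)
open import Relation.Binary.Definitions using (tri<; tri≈; tri>)
open import Relation.Binary.PropositionalEquality
  using (_≡_; _≢_; refl; sym; trans; cong; cong₂; subst; subst₂; module ≡-Reasoning)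
open import Relation.Nullary using (¬_; Dec; yes; no; does; contradiction)
open import Relation.Nullary.Decidable using (dec-true; dec-false; does-⇔)
open import Relation.Unary using (Pred; Decidable)

-- No bijection is built between the tableaux with descent `k` and those with descent `k + 1`:
-- exchanging two consecutive entries can also alter the neighbouring descents. Signed indicators
-- are compared instead, so that each exchange only has to cancel its own term. This needs the
-- contents of `k`, `k + 1`, `k + 2` to be pairwise distinct integers. The coefficient arises as
-- follows. Let F be the number of tableaux and K the total content. Entry 1 always sits in the
-- corner, with content 0, so the sums over tableaux are 0, 1, ..., n - 1 times the slope F - 2Δ,
-- and F K = C(n,2) (F - 2Δ). Here K is the sum of the column indices less that of the row indices,
-- Σ C(λ_i,2) - Σ C(λ'_j,2), and n(n-1) = 2 C(n,2); this yields Δ n(n-1) = numerator · F. Passing to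
-- the ratio Δ / F requires F > 0, which is why a standard tableau is constructed. Since the
-- coefficient is rational, the real identity can be checked term by term on Cauchy sequences.

module ListSum (M : CommutativeMonoid 0ℓ 0ℓ) where
  open CommutativeMonoid M renaming (refl to ≈-refl; sym to ≈-sym; trans to ≈-trans; _≈_ to _≋_)
  open import Algebra.Properties.CommutativeSemigroup commutativeSemigroup using (interchange; x∙yz≈y∙xz)
  open import Algebra.Properties.CommutativeMonoid.Mult M using () renaming (_×_ to _·ⁿ_) public
  open import Relation.Binary.Reasoning.Setoid setoid

  private variable A B : Set

  ∑ : List A → (A → Carrier) → Carrier
  ∑ xs g = foldr _∙_ ε (map g xs)

  ∑-cong : ∀ (xs : List A) {g h} → (∀ {x} → x ∈ xs → g x ≋ h x) → ∑ xs g ≋ ∑ xs h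
  ∑-cong []       g≋h = ≈-refl
  ∑-cong (x ∷ xs) g≋h = ∙-cong (g≋h (here refl)) (∑-cong xs (g≋h ∘ there))

  ∑-distrib : ∀ (xs : List A) g h → ∑ xs (λ x → g x ∙ h x) ≋ ∑ xs g ∙ ∑ xs h
  ∑-distrib []       g h = ≈-sym (identityˡ ε)
  ∑-distrib (x ∷ xs) g h = ≈-trans (∙-congˡ (∑-distrib xs g h)) (interchange _ _ _ _)

  ∑-const : ∀ (xs : List A) c → ∑ xs (λ _ → c) ≋ length xs ·ⁿ c
  ∑-const []       c = ≈-refl
  ∑-const (x ∷ xs) c = ∙-congˡ (∑-const xs c)

  ∑-zero : ∀ (xs : List A) → ∑ xs (λ _ → ε) ≋ ε
  ∑-zero []       = ≈-refl
  ∑-zero (x ∷ xs) = ≈-trans (identityˡ _) (∑-zero xs)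

  ∑-exchange : ∀ (xs : List A) (ys : List B) (g : A → B → Carrier) →
               ∑ xs (λ x → ∑ ys (g x)) ≋ ∑ ys (λ y → ∑ xs (λ x → g x y))
  ∑-exchange []       ys g = ≈-sym (∑-zero ys)
  ∑-exchange (x ∷ xs) ys g = begin
    ∑ ys (g x) ∙ ∑ xs (λ x → ∑ ys (g x))              ≈⟨ ∙-congˡ (∑-exchange xs ys g) ⟩
    ∑ ys (g x) ∙ ∑ ys (λ y → ∑ xs (λ x → g x y))      ≈⟨ ∑-distrib ys _ _ ⟨
    ∑ ys (λ y → g x y ∙ ∑ xs (λ x → g x y))           ∎

  ∑-map : ∀ (φ : A → B) xs g → ∑ (map φ xs) g ≋ ∑ xs (g ∘ φ)
  ∑-map φ []       g = ≈-refl
  ∑-map φ (x ∷ xs) g = ∙-congˡ (∑-map φ xs g)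

  ∑-++ : ∀ (xs ys : List A) g → ∑ (xs ++ ys) g ≋ ∑ xs g ∙ ∑ ys g
  ∑-++ []       ys g = ≈-sym (identityˡ _)
  ∑-++ (x ∷ xs) ys g = ≈-trans (∙-congˡ (∑-++ xs ys g)) (≈-sym (assoc _ _ _))

  ∑-↭ : ∀ {xs ys : List A} g → xs ↭ ys → ∑ xs g ≋ ∑ ys g
  ∑-↭ g ↭.refl         = ≈-refl
  ∑-↭ g (↭.prep x p)   = ∙-congˡ (∑-↭ g p)
  ∑-↭ g (↭.swap x y p) = ≈-trans (∙-congˡ (∙-congˡ (∑-↭ g p))) (x∙yz≈y∙xz _ _ _)
  ∑-↭ g (↭.trans p q)  = ≈-trans (∑-↭ g p) (∑-↭ g q)

  ∑-filter : ∀ {P : Pred A 0ℓ} (P? : Decidable P) xs g →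
             ∑ (filter P? xs) g ≋ ∑ xs (λ x → if does (P? x) then g x else ε)
  ∑-filter P? []       g = ≈-refl
  ∑-filter P? (x ∷ xs) g with does (P? x)
  ... | true  = ∙-congˡ (∑-filter P? xs g)
  ... | false = ≈-trans (∑-filter P? xs g) (≈-sym (identityˡ _))

  -- Double counting of the related pairs: with the filter written as an indicator the two sums
  -- commute, and for fixed `y` the summand is constant, which leaves a multiple of `g y`.
  ∑-filter-exchange : ∀ {P : A → B → Set} (P? : ∀ x y → Dec (P x y)) xs ys (g : B → Carrier) →
    ∑ xs (λ x → ∑ (filter (P? x) ys) g) ≋
    ∑ ys (λ y → length (filter (λ x → P? x y) xs) ·ⁿ g y)
  ∑-filter-exchange P? xs ys g = begin
    ∑ xs (λ x → ∑ (filter (P? x) ys) g)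
      ≈⟨ ∑-cong xs (λ _ → ∑-filter (P? _) ys g) ⟩
    ∑ xs (λ x → ∑ ys (λ y → if does (P? x y) then g y else ε))
      ≈⟨ ∑-exchange xs ys _ ⟩
    ∑ ys (λ y → ∑ xs (λ x → if does (P? x y) then g y else ε))
      ≈⟨ ∑-cong ys (λ {y} _ → ≈-trans
           (≈-sym (∑-filter (λ x → P? x y) xs (λ _ → g y)))
           (∑-const (filter (λ x → P? x y) xs) (g y))) ⟩
    ∑ ys (λ y → length (filter (λ x → P? x y) xs) ·ⁿ g y) ∎

  ∑-·ⁿ : ∀ k (xs : List A) g → ∑ xs (λ x → k ·ⁿ g x) ≋ k ·ⁿ ∑ xs g
  ∑-·ⁿ zero    xs g = ∑-zero xs
  ∑-·ⁿ (suc k) xs g = ≈-trans (∑-distrib xs _ _) (∙-congˡ (∑-·ⁿ k xs g))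

private variable
  ps : List ℕ
  n  : ℕ

-- Cells of a diagram.

cell-≡ : {c d : Cell ps} → row c ≡ row d → col c ≡ col d → c ≡ d
cell-≡ {c = cell i j} {cell i′ j′} r s with Fin.toℕ-injective r
... | refl with Fin.toℕ-injective s
...   | refl = refl

below : ∀ {p} → Cell ps → Cell (p ∷ ps)
below (cell i j) = cell (suc i) j

below-injective : ∀ {p} {c d : Cell ps} → below {p = p} c ≡ below d → c ≡ d
below-injective {c = cell i j} {cell .i .j} refl = refl

cells : ∀ ps → List (Cell ps)
cells []       = []
cells (p ∷ ps) = map (cell zero) (allFin p) ++ map below (cells ps)

∈-cells : ∀ (c : Cell ps) → c ∈ cells ps
∈-cells {ps = p ∷ ps} (cell zero j)    = ∈-++⁺ˡ (∈-map⁺ (cell zero) (∈-allFin j))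
∈-cells {ps = p ∷ ps} (cell (suc i) j) =
  ∈-++⁺ʳ (map (cell zero) (allFin p)) (∈-map⁺ below (∈-cells (cell i j)))

cells-unique : ∀ ps → Unique (cells ps)
cells-unique []       = []
cells-unique (p ∷ ps) = Unique.++⁺
  (Unique.map⁺ (λ { refl → refl }) (Unique.allFin⁺ p))
  (Unique.map⁺ below-injective (cells-unique ps))
  λ (x , y) → disjoint x y
  where
  disjoint : ∀ {c} → c ∈ map (cell zero) (allFin p) → c ∈ map below (cells ps) → ⊥
  disjoint x y with ∈-map⁻ (cell zero) x | ∈-map⁻ below y
  ... | _ , _ , refl | _ , _ , ()

lookup-antitone : ∀ {ps} → Linked ℕ._≥_ ps → ∀ {i j : Fin (length ps)} →
                  toℕ i ℕ.≤ toℕ j → lookup ps j ℕ.≤ lookup ps i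
lookup-antitone l = go (Linked⇒AllPairs (λ x≥y y≥z → ℕ.≤-trans y≥z x≥y) l)
  where
  go : ∀ {ps} → AllPairs ℕ._≥_ ps → ∀ {i j : Fin (length ps)} →
       toℕ i ℕ.≤ toℕ j → lookup ps j ℕ.≤ lookup ps i
  go (_ ∷ _)  {zero}  {zero}  _         = ℕ.≤-refl
  go (p ∷ _)  {zero}  {suc j} _         = All.lookup p (∈-lookup j)
  go (_ ∷ ap) {suc i} {suc j} (ℕ.s≤s q) = go ap q

-- Contents, and the relative position of cells with nearby labels.

content : Cell ps → ℤ
content c = + col c ℤ.- + row c

-- The subtractions are moved across because rows and columns are compared in ℕ.
same-diagonal : (c d : Cell ps) → content c ≡ content d → col c ℕ.+ row d ≡ col d ℕ.+ row c
same-diagonal c d eq = ℤ.+-injective (begin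
  + col c ℤ.+ + row d                     ≡⟨ lhs (+ col c) (+ row c) (+ row d) ⟩
  content c ℤ.+ (+ row c ℤ.+ + row d)     ≡⟨ cong (ℤ._+ (+ row c ℤ.+ + row d)) eq ⟩
  content d ℤ.+ (+ row c ℤ.+ + row d)     ≡⟨ rhs (+ col d) (+ row d) (+ row c) ⟩
  + col d ℤ.+ + row c                     ∎)
  where
  open ≡-Reasoning
  lhs : ∀ a b c → a ℤ.+ c ≡ (a ℤ.- b) ℤ.+ (b ℤ.+ c)
  lhs = solve-∀
  rhs : ∀ a b c → (a ℤ.- b) ℤ.+ (c ℤ.+ b) ≡ a ℤ.+ c
  rhs = solve-∀

module _ {ps : List ℕ} (decr : Linked ℕ._≥_ ps) where

  -- Rows above that of `d` are at least as long. This supplies the intermediate cells whose labels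
  -- produce the contradictions below.
  order-ideal : ∀ (d : Cell ps) {r s} → r ℕ.≤ row d → s ℕ.≤ col d →
                ∃ λ (c : Cell ps) → row c ≡ r × col c ≡ s
  order-ideal d {r} {s} r≤ s≤ = cell (fromℕ< r<) (fromℕ< s<) , row≡ , Fin.toℕ-fromℕ< s<
    where
    r< : r ℕ.< length ps
    r< = ℕ.≤-<-trans r≤ (Fin.toℕ<n (rowIx d))
    row≡ : toℕ (fromℕ< r<) ≡ r
    row≡ = Fin.toℕ-fromℕ< r<
    s< : s ℕ.< lookup ps (fromℕ< r<)
    s< = ℕ.<-≤-trans (ℕ.≤-<-trans s≤ (Fin.toℕ<n (colIx d)))
           (lookup-antitone decr (subst (ℕ._≤ row d) (sym row≡) r≤))

  module _ {n} {T : Filling n ps} (std : IsStandard T) where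
    open IsStandard std

    private
      label′ : Cell ps → ℕ
      label′ = label T

    label-injective : ∀ {c d} → label T c ≡ label T d → c ≡ d
    label-injective = proj₁ eachOnce ∘ Fin.toℕ-injective ∘ ℕ.suc-injective

    label-mono : ∀ {c d} → row c ℕ.≤ row d → col c ℕ.≤ col d → label T c ℕ.≤ label T d
    -- `m` lies in the row of `d` and the column of `c`, so the path from `c` goes down to `m` and
    -- then right to `d`.
    label-mono {c} {d} r s with order-ideal d ℕ.≤-refl s
    ... | m , mr , mc = ℕ.≤-trans c≤m m≤d
      where
      c≤m : label T c ℕ.≤ label T m
      c≤m with ℕ.m≤n⇒m<n∨m≡n r
      ... | inj₁ r< = ℕ.<⇒≤ (increasing↓ c m (sym mc) (subst (row c ℕ.<_) (sym mr) r<))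
      ... | inj₂ r≡ = ℕ.≤-reflexive (cong label′ (cell-≡ (trans r≡ (sym mr)) (sym mc)))
      m≤d : label T m ℕ.≤ label T d
      m≤d with ℕ.m≤n⇒m<n∨m≡n s
      ... | inj₁ s< = ℕ.<⇒≤ (increasing→ m d mr (subst (ℕ._< col d) (sym mc) s<))
      ... | inj₂ s≡ = ℕ.≤-reflexive (cong label′ (cell-≡ mr (trans mc s≡)))

    module _ {u v : Cell ps} (uv : label T v ≡ suc (label T u)) where

      private
        nothing-between : ∀ m → label T u ℕ.< label T m → ¬ (label T m ℕ.< label T v)
        nothing-between m u<m m<v = ℕ.<⇒≱ u<m (ℕ.s≤s⁻¹ (subst (label T m ℕ.<_) uv m<v))

        v≰u : ¬ (label T v ℕ.≤ label T u)
        v≰u v≤u = ℕ.1+n≰n (subst (ℕ._≤ label T u) uv v≤u)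

      -- If `v` were strictly east of `u`, the cell in the row of `v` and the column of `u` would
      -- hold a label strictly between two consecutive ones.
      descent⇒weakly-west : row u ℕ.< row v → col v ℕ.≤ col u
      descent⇒weakly-west r with col v ℕ.≤? col u
      ... | yes p = p
      ... | no  p with order-ideal v ℕ.≤-refl (ℕ.<⇒≤ (ℕ.≰⇒> p))
      ...   | m , mr , mc = contradiction
        (increasing→ m v mr (subst (ℕ._< col v) (sym mc) (ℕ.≰⇒> p)))
        (nothing-between m (increasing↓ u m (sym mc) (subst (row u ℕ.<_) (sym mr) r)))

      -- Otherwise `v` would lie weakly northwest of `u` and could not carry the larger label.
      ascent⇒strictly-east : row v ℕ.≤ row u → col u ℕ.< col v
      ascent⇒strictly-east r = ℕ.≰⇒> λ s → v≰u (label-mono r s)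

      descent⇒content> : row u ℕ.< row v → content v ℤ.< content u
      descent⇒content> r =
        ℤ.+-mono-≤-< (ℤ.+≤+ (descent⇒weakly-west r)) (ℤ.neg-mono-< (ℤ.+<+ r))

      ascent⇒content< : row v ℕ.≤ row u → content u ℤ.< content v
      ascent⇒content< r =
        ℤ.+-mono-<-≤ (ℤ.+<+ (ascent⇒strictly-east r)) (ℤ.neg-mono-≤ (ℤ.+≤+ r))

      -- A gap would leave room, immediately to the right of `u`, for a cell with a label strictly
      -- in between.
      same-row⇒adjacent : row u ≡ row v → col v ≡ suc (col u)
      same-row⇒adjacent r with ℕ.m≤n⇒m<n∨m≡n (ascent⇒strictly-east (ℕ.≤-reflexive (sym r)))
      ... | inj₂ s≡ = sym s≡
      ... | inj₁ s< with order-ideal v ℕ.≤-refl (ℕ.<⇒≤ s<)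
      ...   | m , mr , mc = contradiction
        (increasing→ m v mr (subst (ℕ._< col v) (sym mc) s<))
        (nothing-between m (increasing→ u m (trans r (sym mr)) (subst (col u ℕ.<_) (sym mc) (ℕ.n<1+n _))))

      same-col⇒adjacent : col u ≡ col v → row v ≡ suc (row u)
      same-col⇒adjacent s with ℕ.m≤n⇒m<n∨m≡n (ℕ.≰⇒> λ r → v≰u (label-mono r (ℕ.≤-reflexive (sym s))))
      ... | inj₂ r≡ = sym r≡
      ... | inj₁ r< with order-ideal v (ℕ.<⇒≤ r<) ℕ.≤-refl
      ...   | m , mr , mc = contradiction
        (increasing↓ m v mc (subst (ℕ._< row v) (sym mr) r<))
        (nothing-between m (increasing↓ u m (trans s (sym mc)) (subst (row u ℕ.<_) (sym mr) (ℕ.n<1+n _))))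

    -- Cells of equal content lie on a common diagonal, so both remaining
    -- corners of the rectangle they span carry labels strictly in between.
    content-≢ : ∀ {u w} → label T w ≡ suc (suc (label T u)) → content u ≢ content w
    content-≢ {u} {w} uw eq = corners (order-ideal w (ℕ.<⇒≤ r) ℕ.≤-refl) (order-ideal w ℕ.≤-refl (ℕ.<⇒≤ s))
      where
      u<w : label T u ℕ.< label T w
      u<w = subst (label T u ℕ.<_) (sym uw) (ℕ.m≤n⇒m≤1+n ℕ.≤-refl)
      r : row u ℕ.< row w
      r = ℕ.≰⇒> λ r≥ → ℕ.<⇒≱ u<w
        (label-mono r≥ (ℕ.≮⇒≥ λ s → ℕ.<⇒≢ (ℕ.+-mono-<-≤ s r≥) (same-diagonal u w eq)))
      s : col u ℕ.< col w
      s = ℕ.≰⇒> λ s≥ → ℕ.<⇒≢ (ℕ.+-mono-≤-< s≥ r) (sym (same-diagonal u w eq))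
      middle : ∀ x → label T u ℕ.< label T x → label T x ℕ.< label T w → label T x ≡ suc (label T u)
      middle x u<x x<w = ℕ.≤-antisym (ℕ.s≤s⁻¹ (subst (label T x ℕ.<_) uw x<w)) u<x
      corners : (∃ λ (m : Cell ps) → row m ≡ row u × col m ≡ col w) →
                (∃ λ (m : Cell ps) → row m ≡ row w × col m ≡ col u) → ⊥
      corners (m , mr , mc) (m′ , mr′ , mc′) =
        ℕ.<⇒≢ r (trans (sym mr) (trans (cong row m≡m′) mr′))
        where
        m≡m′ : m ≡ m′
        m≡m′ = label-injective (trans
          (middle m  (increasing→ u m (sym mr) (subst (col u ℕ.<_) (sym mc) s))
                     (increasing↓ m w mc (subst (ℕ._< row w) (sym mr) r)))
          (sym (middle m′ (increasing↓ u m′ (sym mc′) (subst (row u ℕ.<_) (sym mr′) r))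
                          (increasing→ m′ w mr′ (subst (ℕ._< col w) (sym mc′) s)))))

-- Exchanging two consecutive entries

module _ {n} (i j : Fin n) where

  transpose-fst : transpose i j i ≡ j
  transpose-fst rewrite dec-true (i Fin.≟ i) refl = refl

  transpose-snd : transpose i j j ≡ i
  transpose-snd with j Fin.≟ i
  ... | yes refl = refl
  ... | no  _ rewrite dec-true (j Fin.≟ j) refl = refl

  transpose-other : ∀ {k} → k ≢ i → k ≢ j → transpose i j k ≡ k
  transpose-other {k} k≢i k≢j
    rewrite dec-false (k Fin.≟ i) k≢i | dec-false (k Fin.≟ j) k≢j = refl

  transpose-involutive : ∀ k → transpose i j (transpose i j k) ≡ k
  transpose-involutive k = go (k Fin.≟ i) (k Fin.≟ j)
    where
    go : Dec (k ≡ i) → Dec (k ≡ j) → transpose i j (transpose i j k) ≡ k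
    go (yes refl) _        = trans (cong (transpose i j) transpose-fst) transpose-snd
    go (no _) (yes refl)   = trans (cong (transpose i j) transpose-snd) transpose-fst
    go (no k≢i) (no k≢j)   = trans (cong (transpose i j) (transpose-other k≢i k≢j))
                                   (transpose-other k≢i k≢j)

  -- An adjacent transposition inverts a single pair of values. Hence all row and column
  -- inequalities of a tableau survive it, except possibly the one between the two exchanged cells.
  transpose-mono-< : toℕ j ≡ suc (toℕ i) → ∀ {a b} → ¬ (a ≡ i × b ≡ j) →
                     a Fin.< b → transpose i j a Fin.< transpose i j b
  transpose-mono-< j≡1+i {a} {b} ¬ij a<b = go (a Fin.≟ i) (a Fin.≟ j) (b Fin.≟ i) (b Fin.≟ j)
    where
    i<j : i Fin.< j
    i<j = ℕ.≤-reflexive (sym j≡1+i)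

    go : Dec (a ≡ i) → Dec (a ≡ j) → Dec (b ≡ i) → Dec (b ≡ j) →
         transpose i j a Fin.< transpose i j b
    go (yes refl) _ (yes refl) _ = contradiction a<b (ℕ.<-irrefl refl)
    go (yes refl) _ _ (yes refl) = contradiction (refl , refl) ¬ij
    go (yes refl) _ (no b≢i) (no b≢j) =
      subst₂ Fin._<_ (sym transpose-fst) (sym (transpose-other b≢i b≢j))
        (ℕ.≤∧≢⇒< (subst (ℕ._≤ toℕ b) (sym j≡1+i) a<b) (b≢j ∘ sym ∘ Fin.toℕ-injective))
    go (no _) (yes refl) (yes refl) _ = contradiction (ℕ.<-trans a<b i<j) (ℕ.<-irrefl refl)
    go (no _) (yes refl) _ (yes refl) = contradiction a<b (ℕ.<-irrefl refl)
    go (no _) (yes refl) (no b≢i) (no b≢j) =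
      subst₂ Fin._<_ (sym transpose-snd) (sym (transpose-other b≢i b≢j)) (ℕ.<-trans i<j a<b)
    go (no a≢i) (no a≢j) (yes refl) _ =
      subst₂ Fin._<_ (sym (transpose-other a≢i a≢j)) (sym transpose-fst) (ℕ.<-trans a<b i<j)
    go (no a≢i) (no a≢j) (no _) (yes refl) =
      subst₂ Fin._<_ (sym (transpose-other a≢i a≢j)) (sym transpose-snd)
        (ℕ.≤∧≢⇒< (ℕ.s≤s⁻¹ (subst (toℕ a ℕ.<_) j≡1+i a<b)) (a≢i ∘ Fin.toℕ-injective))
    go (no a≢i) (no a≢j) (no b≢i) (no b≢j) =
      subst₂ Fin._<_ (sym (transpose-other a≢i a≢j)) (sym (transpose-other b≢i b≢j)) a<b

relabel : (Fin n → Fin n) → Filling n ps → Filling n ps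
relabel φ = All.map (Vec.map φ)

entry-relabel : ∀ φ (T : Filling n ps) c → entry (relabel φ T) c ≡ φ (entry T c)
entry-relabel φ T (cell i j) = trans
  (cong (λ xs → Vec.lookup xs j) (All.lookup-map T (∈-lookup i)))
  (Vec.lookup-map j φ (All.lookup T (∈-lookup i)))

relabel-involutive : ∀ {φ : Fin n → Fin n} → (∀ k → φ (φ k) ≡ k) →
                     ∀ (T : Filling n ps) → relabel φ (relabel φ T) ≡ T
relabel-involutive inv []       = refl
relabel-involutive {φ = φ} inv (xs ∷ T) = cong₂ _∷_
  (trans (sym (Vec.map-∘ φ φ xs)) (trans (Vec.map-cong inv xs) (Vec.map-id xs)))
  (relabel-involutive inv T)

-- The index `k` stands for the labels `toℕ k + 1` and `toℕ k + 2`; the descent position that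
-- belongs to it is therefore `suc (toℕ k)`.
swapEntries : ∀ {m} → Fin m → Filling (suc m) ps → Filling (suc m) ps
swapEntries k = relabel (transpose (inject₁ k) (suc k))

-- Contents of the cells holding given entries.

opaque
  -- A total function on all fillings, so that sums over tableaux need no proof of standardness. The
  -- default 0 is never reached on a standard tableau, where every entry occurs.
  contentAt : Filling n ps → Fin n → ℤ
  contentAt T k with anyCell? (λ c → entry T c Fin.≟ k)
  ... | yes (c , _) = content c
  ... | no  _       = 0ℤ

module _ {T : Filling n ps} (std : IsStandard T) where
  open IsStandard std

  opaque
    unfolding contentAt

    contentAt-entry : ∀ {c k} → entry T c ≡ k → contentAt T k ≡ content c
    contentAt-entry {c} {k} e with anyCell? (λ c → entry T c Fin.≟ k)
    ... | yes (d , e′) = cong content (proj₁ eachOnce (trans e′ (sym e)))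
    ... | no  ∄       = contradiction (c , e) ∄

  cellAt : ∀ k → ∃ λ c → entry T c ≡ k
  cellAt k = proj₁ (proj₂ eachOnce k) , proj₂ (proj₂ eachOnce k) refl

module _ {m} (k : Fin m) {T : Filling (suc m) ps} (std : IsStandard T) where
  open IsStandard std

  private
    i j : Fin (suc m)
    i = inject₁ k
    j = suc k
    T′ : Filling (suc m) ps
    T′ = swapEntries k T

    j≡1+i : toℕ j ≡ suc (toℕ i)
    j≡1+i = cong suc (sym (Fin.toℕ-inject₁ k))

  -- The only inverted comparison is that of `u` with `v`, and standardness imposes none on two
  -- cells with no common row or column.
  swap-standard : ∀ {u v} → entry T u ≡ i → entry T v ≡ j → row u ≢ row v → col u ≢ col v →
                  IsStandard T′
  swap-standard {u} {v} ui vj r≢ c≢ = record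
    { eachOnce    = inj , λ y → let c , e = cellAt std (transpose i j y) in
                      c , λ { refl → trans (entry-relabel _ T c)
                              (trans (cong (transpose i j) e) (transpose-involutive i j y)) }
    ; increasing→ = λ c d r c<d → swapped c d (λ { refl refl → r≢ r }) (increasing→ c d r c<d)
    ; increasing↓ = λ c d s r<r → swapped c d (λ { refl refl → c≢ s }) (increasing↓ c d s r<r)
    }
    where
    inj : ∀ {c d} → entry T′ c ≡ entry T′ d → c ≡ d
    inj {c} {d} e = proj₁ eachOnce (begin
      entry T c                                   ≡⟨ transpose-involutive i j _ ⟨
      transpose i j (transpose i j (entry T c))   ≡⟨ cong (transpose i j) (entry-relabel _ T c) ⟨
      transpose i j (entry T′ c)                  ≡⟨ cong (transpose i j) e ⟩
      transpose i j (entry T′ d)                  ≡⟨ cong (transpose i j) (entry-relabel _ T d) ⟩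
      transpose i j (transpose i j (entry T d))   ≡⟨ transpose-involutive i j _ ⟩
      entry T d                                   ∎)
      where open ≡-Reasoning
    swapped : ∀ c d → (c ≡ u → d ≡ v → ⊥) → label T c ℕ.< label T d → label T′ c ℕ.< label T′ d
    swapped c d ¬uv c<d = ℕ.s≤s (subst₂ Fin._<_ (sym (entry-relabel _ T c)) (sym (entry-relabel _ T d))
      (transpose-mono-< i j j≡1+i
        (λ (ci , dj) → ¬uv (proj₁ eachOnce (trans ci (sym ui))) (proj₁ eachOnce (trans dj (sym vj))))
        (ℕ.s≤s⁻¹ c<d)))

  contentAt-swap : IsStandard T′ → ∀ x → contentAt T′ x ≡ contentAt T (transpose i j x)
  contentAt-swap std′ x with cellAt std (transpose i j x)
  ... | c , e = trans
    (contentAt-entry std′ (trans (entry-relabel _ T c)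
      (trans (cong (transpose i j) e) (transpose-involutive i j x))))
    (sym (contentAt-entry std e))

  module _ (decr : Linked ℕ._≥_ ps) where

    private
      u v : Cell ps
      u = proj₁ (cellAt std i)
      v = proj₁ (cellAt std j)
      ui : entry T u ≡ i
      ui = proj₂ (cellAt std i)
      vj : entry T v ≡ j
      vj = proj₂ (cellAt std j)
      uv : label T v ≡ suc (label T u)
      uv = cong suc (trans (cong toℕ vj) (trans j≡1+i (cong (suc ∘ toℕ) (sym ui))))

    -- Cells with consecutive labels in one row or column are neighbours; a step right raises the
    -- content by one and a step down lowers it by one.
    swap-or-adjacent :
      IsStandard T′ ⊎
      contentAt T j ≡ 1ℤ ℤ.+ contentAt T i ⊎ contentAt T i ≡ 1ℤ ℤ.+ contentAt T j
    swap-or-adjacent with row u ℕ.≟ row v | col u ℕ.≟ col v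
    ... | no r≢ | no s≢ = inj₁ (swap-standard ui vj r≢ s≢)
    ... | yes r | _ = inj₂ (inj₁ (begin
        contentAt T j                      ≡⟨ contentAt-entry std vj ⟩
        + col v ℤ.- + row v                ≡⟨ cong₂ (λ x y → + x ℤ.- + y) (same-row⇒adjacent decr std uv r) (sym r) ⟩
        (1ℤ ℤ.+ + col u) ℤ.- + row u       ≡⟨ ℤ.+-assoc 1ℤ (+ col u) (ℤ.- + row u) ⟩
        1ℤ ℤ.+ content u                   ≡⟨ cong (ℤ._+_ 1ℤ) (contentAt-entry std ui) ⟨
        1ℤ ℤ.+ contentAt T i               ∎))
      where open ≡-Reasoning
    ... | no _ | yes s = inj₂ (inj₂ (begin
        contentAt T i                              ≡⟨ contentAt-entry std ui ⟩
        + col u ℤ.- + row u                        ≡⟨ shift (+ col u) (+ row u) ⟩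
        1ℤ ℤ.+ (+ col u ℤ.- (1ℤ ℤ.+ + row u))      ≡⟨ cong₂ (λ x y → 1ℤ ℤ.+ (+ x ℤ.- + y)) s (sym (same-col⇒adjacent decr std uv s)) ⟩
        1ℤ ℤ.+ content v                           ≡⟨ cong (ℤ._+_ 1ℤ) (contentAt-entry std vj) ⟨
        1ℤ ℤ.+ contentAt T j                       ∎))
      where
      open ≡-Reasoning
      shift : ∀ a b → a ℤ.- b ≡ 1ℤ ℤ.+ (a ℤ.- (1ℤ ℤ.+ b))
      shift = solve-∀

    isDescent⇒content> : IsDescent T (suc (toℕ k)) → contentAt T j ℤ.< contentAt T i
    isDescent⇒content> (c , d , ck , dk , r) =
      subst₂ ℤ._<_ (sym (contentAt-entry std d≡j)) (sym (contentAt-entry std c≡i))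
        (descent⇒content> decr std cd r)
      where
      cd : label T d ≡ suc (label T c)
      cd = trans dk (cong suc (sym ck))
      c≡i : entry T c ≡ i
      c≡i = Fin.toℕ-injective (trans (ℕ.suc-injective ck) (sym (Fin.toℕ-inject₁ k)))
      d≡j : entry T d ≡ j
      d≡j = Fin.toℕ-injective (ℕ.suc-injective dk)

    -- If `v` were not strictly below `u`, it would lie strictly east and its content would be the
    -- larger one.
    content>⇒isDescent : contentAt T j ℤ.< contentAt T i → IsDescent T (suc (toℕ k))
    content>⇒isDescent j<i = u , v ,
      cong suc (trans (cong toℕ ui) (Fin.toℕ-inject₁ k)) , cong (suc ∘ toℕ) vj ,
      ℕ.≰⇒> λ r → ℤ.<-asym (ascent⇒content< decr std uv r)
        (subst₂ ℤ._<_ (contentAt-entry std vj) (contentAt-entry std ui) j<i)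

    contentAt-consecutive-≢ : contentAt T i ≢ contentAt T j
    contentAt-consecutive-≢ e with row v ℕ.≤? row u
    ... | yes r = ℤ.<-irrefl u≡v (ascent⇒content< decr std uv r)
      where
      u≡v : content u ≡ content v
      u≡v = trans (sym (contentAt-entry std ui)) (trans e (contentAt-entry std vj))
    ... | no  r = ℤ.<-irrefl (sym u≡v) (descent⇒content> decr std uv (ℕ.≰⇒> r))
      where
      u≡v : content u ≡ content v
      u≡v = trans (sym (contentAt-entry std ui)) (trans e (contentAt-entry std vj))

-- With `contentAt-consecutive-≢` this makes the contents of three consecutive entries pairwise
-- distinct, as the comparison of neighbouring descent counts requires.
contentAt-gap-≢ : ∀ {m} (k : Fin m) {T : Filling (suc (suc m)) ps} → Linked ℕ._≥_ ps → IsStandard T →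
                  contentAt T (inject₁ (inject₁ k)) ≢ contentAt T (suc (suc k))
contentAt-gap-≢ {ps = ps} {m} k {T} decr std e = content-≢ decr std {proj₁ U} {proj₁ W}
  (cong suc (trans (cong toℕ (proj₂ W)) (cong (λ x → suc (suc x)) (sym (begin
    toℕ (entry T (proj₁ U))          ≡⟨ cong toℕ (proj₂ U) ⟩
    toℕ (inject₁ (inject₁ k))        ≡⟨ Fin.toℕ-inject₁ (inject₁ k) ⟩
    toℕ (inject₁ k)                  ≡⟨ Fin.toℕ-inject₁ k ⟩
    toℕ k                            ∎)))))
  (trans (sym (contentAt-entry std (proj₂ U))) (trans e (contentAt-entry std (proj₂ W))))
  where
  open ≡-Reasoning
  U : ∃ λ c → entry T c ≡ inject₁ (inject₁ k)
  U = cellAt std (inject₁ (inject₁ k))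
  W : ∃ λ c → entry T c ≡ suc (suc k)
  W = cellAt std (suc (suc k))

-- The list of standard tableaux is complete and free of repetitions.

allVecs-complete : ∀ {A : Set} {xs : List A} → (∀ x → x ∈ xs) → ∀ {k} (v : Vec A k) → v ∈ allVecs xs k
allVecs-complete full []      = here refl
allVecs-complete full (x ∷ v) = ∈-cartesianProductWith⁺ _∷_ (full x) (allVecs-complete full v)

allFillings-complete : ∀ {A : Set} {xs : List A} → (∀ x → x ∈ xs) →
                       ∀ {ps} (T : All (Vec A) ps) → T ∈ allFillings xs ps
allFillings-complete full []      = here refl
allFillings-complete full (v ∷ T) =
  ∈-cartesianProductWith⁺ _∷_ (allVecs-complete full v) (allFillings-complete full T)

allVecs-unique : ∀ {A : Set} {xs : List A} → Unique xs → ∀ k → Unique (allVecs xs k)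
allVecs-unique u zero    = [] ∷ []
allVecs-unique u (suc k) =
  Unique.cartesianProductWith⁺ _∷_ (λ { refl → refl , refl }) u (allVecs-unique u k)

allFillings-unique : ∀ {A : Set} {xs : List A} → Unique xs → ∀ ps → Unique (allFillings xs ps)
allFillings-unique u []       = [] ∷ []
allFillings-unique u (p ∷ ps) =
  Unique.cartesianProductWith⁺ _∷_ (λ { refl → refl , refl }) (allVecs-unique u p) (allFillings-unique u ps)

module _ (Λ : Partition n) where

  standardTableaux-unique : Unique (standardTableaux Λ)
  standardTableaux-unique =
    Unique.filter⁺ isStandard? (allFillings-unique (Unique.allFin⁺ n) (parts Λ))

  ∈-standardTableaux⁺ : ∀ {T} → IsStandard T → T ∈ standardTableaux Λ
  ∈-standardTableaux⁺ {T} = ∈-filter⁺ isStandard? (allFillings-complete ∈-allFin T)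

  ∈-standardTableaux⁻ : ∀ {T} → T ∈ standardTableaux Λ → IsStandard T
  ∈-standardTableaux⁻ = proj₂ ∘ ∈-filter⁻ isStandard? {xs = allFillings (allFin n) (parts Λ)}

↭-of-unique : ∀ {A : Set} {xs ys : List A} → Unique xs → Unique ys →
              (∀ {x} → x ∈ xs → x ∈ ys) → (∀ {x} → x ∈ ys → x ∈ xs) → xs ↭ ys
↭-of-unique u u′ f g = ∼bag⇒↭ (unique∧set⇒bag u u′ (mk⇔ f g))

-- Integer sums, order indicators and sign-reversing involutions.

module ∑ℕ = ListSum ℕ.+-0-commutativeMonoid
module ∑ℤ = ListSum ℤ.+-0-commutativeMonoid
open ∑ℤ using (∑)

private variable
  A : Set

∑-pos : ∀ (xs : List A) (g : A → ℕ) → ∑ xs (λ x → + g x) ≡ + ∑ℕ.∑ xs g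
∑-pos []       g = refl
∑-pos (x ∷ xs) g = cong (ℤ._+_ (+ g x)) (∑-pos xs g)

·ⁿ-one : ∀ k → k ∑ℤ.·ⁿ 1ℤ ≡ + k
·ⁿ-one zero    = refl
·ⁿ-one (suc k) = cong (ℤ._+_ 1ℤ) (·ⁿ-one k)

·ⁿ-* : ∀ k a → k ∑ℤ.·ⁿ a ≡ + k ℤ.* a
·ⁿ-* zero    a = refl
·ⁿ-* (suc k) a = trans (cong (ℤ._+_ a) (·ⁿ-* k a)) (sym (ℤ.suc-* (+ k) a))

∑-*ʳ : ∀ (xs : List A) g a → ∑ xs (λ x → g x ℤ.* a) ≡ ∑ xs g ℤ.* a
∑-*ʳ []       g a = refl
∑-*ʳ (x ∷ xs) g a = trans (cong (ℤ._+_ (g x ℤ.* a)) (∑-*ʳ xs g a)) (sym (ℤ.*-distribʳ-+ a (g x) _))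

i+i≡0⇒i≡0 : ∀ i → i ℤ.+ i ≡ 0ℤ → i ≡ 0ℤ
i+i≡0⇒i≡0 (+ zero)     _  = refl
i+i≡0⇒i≡0 (+ suc _)    ()
i+i≡0⇒i≡0 (ℤ.-[1+ _ ]) ()

lt : ℤ → ℤ → ℤ
lt a b = if does (a ℤ.<? b) then 1ℤ else 0ℤ

lt-cong : ∀ {a b c d} → (a ℤ.< b → c ℤ.< d) → (c ℤ.< d → a ℤ.< b) → lt a b ≡ lt c d
lt-cong {a} {b} {c} {d} f g =
  cong (λ t → if t then 1ℤ else 0ℤ) (does-⇔ (mk⇔ f g) (a ℤ.<? b) (c ℤ.<? d))

lt-swap : ∀ {a b} → a ≢ b → lt b a ≡ 1ℤ ℤ.- lt a b
lt-swap {a} {b} a≢b with ℤ.<-cmp a b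
... | tri< a<b _ b≮a rewrite dec-true (a ℤ.<? b) a<b | dec-false (b ℤ.<? a) b≮a = refl
... | tri≈ _ a≡b _ = contradiction a≡b a≢b
... | tri> a≮b _ b<a rewrite dec-false (a ℤ.<? b) a≮b | dec-true (b ℤ.<? a) b<a = refl

-- No integer lies strictly between `a` and `1ℤ ℤ.+ a`, so a third content compares alike with both.
lt-sucˡ : ∀ a w → 1ℤ ℤ.+ a ≢ w → lt (1ℤ ℤ.+ a) w ≡ lt a w
lt-sucˡ a w ne = lt-cong {1ℤ ℤ.+ a} {w} {a} {w}
  (ℤ.<-trans (ℤ.suc[i]≤j⇒i<j ℤ.≤-refl))
  (λ a<w → ℤ.≤∧≢⇒< (ℤ.i<j⇒suc[i]≤j a<w) ne)

∑-indicator : ∀ {P : Pred A 0ℓ} (P? : Decidable P) xs →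
              ∑ xs (λ x → if does (P? x) then 1ℤ else 0ℤ) ≡ + length (filter P? xs)
∑-indicator P? xs = trans (sym (∑ℤ.∑-filter P? xs (λ _ → 1ℤ)))
  (trans (∑ℤ.∑-const (filter P? xs) 1ℤ) (·ⁿ-one (length (filter P? xs))))

module _ {P : Pred A 0ℓ} (P? : Decidable P) {xs : List A} (xs-unique : Unique xs)
         (∈⇒P : ∀ {x} → x ∈ xs → P x) (P⇒∈ : ∀ {x} → P x → x ∈ xs)
         (σ : A → A) (σσ : ∀ x → σ (σ x) ≡ x)
         where

  -- The involution may leave `P`, but `g` vanishes wherever it does, so only the part that it
  -- preserves matters. Adding the sum over that part to its reindexing by `σ` cancels termwise;
  -- this shows that twice the sum is zero, and ℤ has no 2-torsion.
  ∑-sign-reversing : (g : A → ℤ) → (∀ {x} → P x → P (σ x) → g (σ x) ≡ ℤ.- g x) →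
                     (∀ {x} → P x → ¬ P (σ x) → g x ≡ 0ℤ) → ∑ xs g ≡ 0ℤ
  ∑-sign-reversing g anti fixed = i+i≡0⇒i≡0 (∑ xs g) (begin
    ∑ xs g ℤ.+ ∑ xs g                        ≡⟨ cong₂ ℤ._+_ restrict (trans restrict reindex) ⟩
    ∑ good g ℤ.+ ∑ good (g ∘ σ)              ≡⟨ ∑ℤ.∑-distrib good g (g ∘ σ) ⟨
    ∑ good (λ x → g x ℤ.+ g (σ x))           ≡⟨ ∑ℤ.∑-cong good cancel ⟩
    ∑ good (λ _ → 0ℤ)                        ≡⟨ ∑ℤ.∑-zero good ⟩
    0ℤ                                       ∎)
    where
    open ≡-Reasoning

    good : List A
    good = filter (P? ∘ σ) xs

    ∈-good⁻ : ∀ {x} → x ∈ good → P x × P (σ x)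
    ∈-good⁻ x∈ with ∈-filter⁻ (P? ∘ σ) {xs = xs} x∈
    ... | x∈xs , Pσx = ∈⇒P x∈xs , Pσx

    σ-good : ∀ {x} → x ∈ good → σ x ∈ good
    σ-good {x} x∈ with ∈-good⁻ x∈
    ... | Px , Pσx = ∈-filter⁺ (P? ∘ σ) (P⇒∈ Pσx) (subst P (sym (σσ x)) Px)

    restrict : ∑ xs g ≡ ∑ good g
    restrict = sym (trans (∑ℤ.∑-filter (P? ∘ σ) xs g) (∑ℤ.∑-cong xs pointwise))
      where
      pointwise : ∀ {x} → x ∈ xs → (if does (P? (σ x)) then g x else 0ℤ) ≡ g x
      pointwise {x} x∈ with P? (σ x)
      ... | yes _   = refl
      ... | no ¬Pσx = sym (fixed (∈⇒P x∈) ¬Pσx)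

    good-unique : Unique good
    good-unique = Unique.filter⁺ (P? ∘ σ) xs-unique

    σ-permutes : good ↭ map σ good
    σ-permutes = ↭-of-unique good-unique
      (Unique.map⁺ (λ {x} {y} e → trans (sym (σσ x)) (trans (cong σ e) (σσ y))) good-unique)
      (λ {x} x∈ → subst (_∈ map σ good) (σσ x) (∈-map⁺ σ (σ-good x∈)))
      (λ σx∈ → case ∈-map⁻ σ σx∈ of λ { (x , x∈ , refl) → σ-good x∈ })

    reindex : ∑ good g ≡ ∑ good (g ∘ σ)
    reindex = trans (∑ℤ.∑-↭ g σ-permutes) (∑ℤ.∑-map σ good g)

    cancel : ∀ {x} → x ∈ good → g x ℤ.+ g (σ x) ≡ 0ℤ
    cancel {x} x∈ with ∈-good⁻ x∈
    ... | Px , Pσx = trans (cong (ℤ._+_ (g x)) (anti Px Pσx)) (ℤ.+-inverseʳ (g x))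

-- Descent counts and sums of contents over all tableaux.

descentCount : List (Filling n ps) → ℕ → ℕ
descentCount Ts i = length (filter (λ T → isDescent? T i) Ts)

module _ {m} (Λ : Partition (suc m)) where

  private
    tabs : List (Filling (suc m) (parts Λ))
    tabs = standardTableaux Λ

  -- The involution is the exchange at `k`. By `swap-or-adjacent` it leaves the standard tableaux
  -- only where the two contents differ by exactly one, so `g` has to vanish just there.
  ∑-antisymmetric : ∀ (k : Fin m) (g : Filling (suc m) (parts Λ) → ℤ) →
    (∀ {T} → IsStandard T → IsStandard (swapEntries k T) → g (swapEntries k T) ≡ ℤ.- g T) →
    (∀ {T} → IsStandard T →
       contentAt T (suc k) ≡ 1ℤ ℤ.+ contentAt T (inject₁ k) ⊎
       contentAt T (inject₁ k) ≡ 1ℤ ℤ.+ contentAt T (suc k) → g T ≡ 0ℤ) →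
    ∑ tabs g ≡ 0ℤ
  ∑-antisymmetric k g anti fixed = ∑-sign-reversing isStandard?
    (standardTableaux-unique Λ) (∈-standardTableaux⁻ Λ) (∈-standardTableaux⁺ Λ)
    (swapEntries k) (relabel-involutive (transpose-involutive (inject₁ k) (suc k)))
    g anti λ std ¬std′ → case swap-or-adjacent k std (decreasing Λ) of λ where
      (inj₁ std′) → contradiction std′ ¬std′
      (inj₂ adj)  → fixed std adj

  ∑-descents : ∀ (k : Fin m) →
    ∑ tabs (λ T → lt (contentAt T (suc k)) (contentAt T (inject₁ k))) ≡ + descentCount tabs (suc (toℕ k))
  ∑-descents k = begin
    ∑ tabs (λ T → lt (contentAt T (suc k)) (contentAt T (inject₁ k)))
      ≡⟨ ∑ℤ.∑-cong tabs (λ T∈ → cong (λ t → if t then 1ℤ else 0ℤ) (agree (∈-standardTableaux⁻ Λ T∈))) ⟩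
    ∑ tabs (λ T → if does (isDescent? T i) then 1ℤ else 0ℤ)
      ≡⟨ ∑-indicator (λ T → isDescent? T i) tabs ⟩
    + descentCount tabs i ∎
    where
    open ≡-Reasoning
    i : ℕ
    i = suc (toℕ k)
    agree : ∀ {T} → IsStandard T →
      does (contentAt T (suc k) ℤ.<? contentAt T (inject₁ k)) ≡ does (isDescent? T i)
    agree {T} std = does-⇔
      (mk⇔ (content>⇒isDescent k std (decreasing Λ)) (isDescent⇒content> k std (decreasing Λ)))
      (contentAt T (suc k) ℤ.<? contentAt T (inject₁ k)) (isDescent? T i)

  contentSum : Fin (suc m) → ℤ
  contentSum k = ∑ tabs (λ T → contentAt T k)

  tableauCount : ℕ
  tableauCount = length tabs

  contentSum-step : ∀ k → contentSum (suc k) ℤ.+ (+ descentCount tabs (suc (toℕ k)) ℤ.+ + descentCount tabs (suc (toℕ k))) ≡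
                          contentSum (inject₁ k) ℤ.+ + tableauCount
  contentSum-step k = begin
    contentSum (suc k) ℤ.+ (+ descentCount tabs (suc (toℕ k)) ℤ.+ + descentCount tabs (suc (toℕ k)))
      ≡⟨ cong (λ d → contentSum (suc k) ℤ.+ (d ℤ.+ d)) (∑-descents k) ⟨
    ∑ tabs y ℤ.+ (∑ tabs δ ℤ.+ ∑ tabs δ)
      ≡⟨ cong (ℤ._+_ (∑ tabs y)) (∑ℤ.∑-distrib tabs δ δ) ⟨
    ∑ tabs y ℤ.+ ∑ tabs (λ T → δ T ℤ.+ δ T)
      ≡⟨ ∑ℤ.∑-distrib tabs y (λ T → δ T ℤ.+ δ T) ⟨
    ∑ tabs (λ T → y T ℤ.+ (δ T ℤ.+ δ T))
      ≡⟨ ∑ℤ.∑-cong tabs (λ {T} _ → rearrange (x T) (y T) (δ T)) ⟩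
    ∑ tabs (λ T → h T ℤ.+ (x T ℤ.+ 1ℤ))
      ≡⟨ ∑ℤ.∑-distrib tabs h (λ T → x T ℤ.+ 1ℤ) ⟩
    ∑ tabs h ℤ.+ ∑ tabs (λ T → x T ℤ.+ 1ℤ)
      ≡⟨ cong₂ ℤ._+_ (∑-antisymmetric k h anti fixed) (∑ℤ.∑-distrib tabs x (λ _ → 1ℤ)) ⟩
    0ℤ ℤ.+ (∑ tabs x ℤ.+ ∑ tabs (λ _ → 1ℤ))
      ≡⟨ ℤ.+-identityˡ _ ⟩
    ∑ tabs x ℤ.+ ∑ tabs (λ _ → 1ℤ)
      ≡⟨ cong (ℤ._+_ (∑ tabs x)) (trans (∑ℤ.∑-const tabs 1ℤ) (·ⁿ-one tableauCount)) ⟩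
    contentSum (inject₁ k) ℤ.+ + tableauCount ∎
    where
    open ≡-Reasoning
    x y δ h : Filling (suc m) (parts Λ) → ℤ
    x T = contentAt T (inject₁ k)
    y T = contentAt T (suc k)
    δ T = lt (y T) (x T)
    -- The second term is +1 at an ascent and -1 at a descent. Exchanging the entries negates it
    -- together with the content difference, and for neighbouring cells the two are equal.
    h T = (y T ℤ.- x T) ℤ.- (1ℤ ℤ.- (δ T ℤ.+ δ T))

    rearrange : ∀ x y d → y ℤ.+ (d ℤ.+ d) ≡ ((y ℤ.- x) ℤ.- (1ℤ ℤ.- (d ℤ.+ d))) ℤ.+ (x ℤ.+ 1ℤ)
    rearrange = solve-∀

    flip : ∀ x y d → (x ℤ.- y) ℤ.- (1ℤ ℤ.- ((1ℤ ℤ.- d) ℤ.+ (1ℤ ℤ.- d))) ≡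
                     ℤ.- ((y ℤ.- x) ℤ.- (1ℤ ℤ.- (d ℤ.+ d)))
    flip = solve-∀

    anti : ∀ {T} → IsStandard T → IsStandard (swapEntries k T) → h (swapEntries k T) ≡ ℤ.- h T
    anti {T} std std′ = begin
      h (swapEntries k T)
        ≡⟨ cong₂ (λ x y → (y ℤ.- x) ℤ.- (1ℤ ℤ.- (lt y x ℤ.+ lt y x)))
             (trans (contentAt-swap k std std′ (inject₁ k)) (cong (contentAt T) (transpose-fst (inject₁ k) (suc k))))
             (trans (contentAt-swap k std std′ (suc k)) (cong (contentAt T) (transpose-snd (inject₁ k) (suc k)))) ⟩
      (x T ℤ.- y T) ℤ.- (1ℤ ℤ.- (lt (x T) (y T) ℤ.+ lt (x T) (y T)))
        ≡⟨ cong (λ d → (x T ℤ.- y T) ℤ.- (1ℤ ℤ.- (d ℤ.+ d)))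
             (lt-swap (λ e → contentAt-consecutive-≢ k std (decreasing Λ) (sym e))) ⟩
      (x T ℤ.- y T) ℤ.- (1ℤ ℤ.- ((1ℤ ℤ.- δ T) ℤ.+ (1ℤ ℤ.- δ T)))
        ≡⟨ flip (x T) (y T) (δ T) ⟩
      ℤ.- h T ∎

    -- The constants 0 and 1 are the values of `δ` for neighbours in a row and in a column.
    up : ∀ a → ((1ℤ ℤ.+ a) ℤ.- a) ℤ.- (1ℤ ℤ.- (0ℤ ℤ.+ 0ℤ)) ≡ 0ℤ
    up = solve-∀
    down : ∀ a → (a ℤ.- (1ℤ ℤ.+ a)) ℤ.- (1ℤ ℤ.- (1ℤ ℤ.+ 1ℤ)) ≡ 0ℤ
    down = solve-∀

    a<1+a : ∀ a → a ℤ.< 1ℤ ℤ.+ a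
    a<1+a a = ℤ.suc[i]≤j⇒i<j ℤ.≤-refl

    fixed : ∀ {T} → IsStandard T → y T ≡ 1ℤ ℤ.+ x T ⊎ x T ≡ 1ℤ ℤ.+ y T → h T ≡ 0ℤ
    fixed {T} _ (inj₁ e) rewrite e
      | dec-false ((1ℤ ℤ.+ x T) ℤ.<? x T) (ℤ.<-asym (a<1+a (x T))) = up (x T)
    fixed {T} _ (inj₂ e) rewrite e
      | dec-true (y T ℤ.<? (1ℤ ℤ.+ y T)) (a<1+a (y T)) = down (y T)

inject₁<suc : ∀ {m} (k : Fin m) → inject₁ k Fin.< suc k
inject₁<suc k = ℕ.s≤s (ℕ.≤-reflexive (Fin.toℕ-inject₁ k))

descentCount-step : ∀ {m} (Λ : Partition (suc (suc m))) (k : Fin m) →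
  descentCount (standardTableaux Λ) (suc (toℕ (inject₁ k))) ≡ descentCount (standardTableaux Λ) (suc (suc (toℕ k)))
descentCount-step {m} Λ k = ℤ.+-injective (begin
  + descentCount tabs (suc (toℕ (inject₁ k)))
    ≡⟨ ∑-descents Λ (inject₁ k) ⟨
  ∑ tabs (λ T → lt (y T) (x T))
    ≡⟨ ∑ℤ.∑-cong tabs split ⟩
  ∑ tabs (λ T → (p T ℤ.+ q T) ℤ.+ lt (z T) (y T))
    ≡⟨ ∑ℤ.∑-distrib tabs (λ T → p T ℤ.+ q T) (λ T → lt (z T) (y T)) ⟩
  ∑ tabs (λ T → p T ℤ.+ q T) ℤ.+ ∑ tabs (λ T → lt (z T) (y T))
    ≡⟨ cong₂ ℤ._+_
         (trans (∑ℤ.∑-distrib tabs p q)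
           (cong₂ ℤ._+_ (∑-antisymmetric Λ (suc k) p p-anti p-fixed)
                        (∑-antisymmetric Λ (inject₁ k) q q-anti q-fixed)))
         (∑-descents Λ (suc k)) ⟩
  0ℤ ℤ.+ + descentCount tabs (suc (suc (toℕ k)))
    ≡⟨ ℤ.+-identityˡ _ ⟩
  + descentCount tabs (suc (suc (toℕ k))) ∎)
  where
  open ≡-Reasoning
  tabs : List (Filling (suc (suc m)) (parts Λ))
  tabs = standardTableaux Λ

  i₀ i₁ i₂ : Fin (suc (suc m))
  i₀ = inject₁ (inject₁ k)
  i₁ = inject₁ (suc k)
  i₂ = suc (suc k)

  -- [y < x] - [z < y] = p + q, where p changes sign when y and z are exchanged
  -- and q when x and y are. If the exchange is impossible, the two contents are
  -- consecutive integers, the third one lies on one side of both, and the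
  -- summand vanishes.
  x y z p q : Filling (suc (suc m)) (parts Λ) → ℤ
  x T = contentAt T i₀
  y T = contentAt T i₁
  z T = contentAt T i₂
  p T = lt (y T) (x T) ℤ.- lt (z T) (x T)
  q T = lt (y T) (z T) ℤ.- lt (x T) (z T)

  x≢y : ∀ {T} → IsStandard T → x T ≢ y T
  x≢y std = contentAt-consecutive-≢ (inject₁ k) std (decreasing Λ)
  y≢z : ∀ {T} → IsStandard T → y T ≢ z T
  y≢z std = contentAt-consecutive-≢ (suc k) std (decreasing Λ)
  x≢z : ∀ {T} → IsStandard T → x T ≢ z T
  x≢z std = contentAt-gap-≢ k (decreasing Λ) std

  combine : ∀ a b c → a ≡ ((a ℤ.- b) ℤ.+ ((1ℤ ℤ.- c) ℤ.- (1ℤ ℤ.- b))) ℤ.+ c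
  combine = solve-∀

  -- Distinctness turns both indicators in `q` into complements of the reversed comparisons; then
  -- `lt (z T) (x T)` cancels against its occurrence in `p`.
  split : ∀ {T} → T ∈ tabs → lt (y T) (x T) ≡ (p T ℤ.+ q T) ℤ.+ lt (z T) (y T)
  split {T} T∈ = begin
    lt (y T) (x T)
      ≡⟨ combine _ (lt (z T) (x T)) (lt (z T) (y T)) ⟩
    (p T ℤ.+ ((1ℤ ℤ.- lt (z T) (y T)) ℤ.- (1ℤ ℤ.- lt (z T) (x T)))) ℤ.+ lt (z T) (y T)
      ≡⟨ cong₂ (λ a b → (p T ℤ.+ (a ℤ.- b)) ℤ.+ lt (z T) (y T))
           (lt-swap (λ e → y≢z std (sym e))) (lt-swap (λ e → x≢z std (sym e))) ⟨
    (p T ℤ.+ q T) ℤ.+ lt (z T) (y T) ∎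
    where
    std : IsStandard T
    std = ∈-standardTableaux⁻ Λ T∈

  i₀<i₁ : i₀ Fin.< i₁
  i₀<i₁ = inject₁<suc (inject₁ k)
  i₁<i₂ : i₁ Fin.< i₂
  i₁<i₂ = inject₁<suc (suc k)
  i₀≢i₂ : i₀ ≢ i₂
  i₀≢i₂ = Fin.<⇒≢ (Fin.<-trans i₀<i₁ i₁<i₂)

  negate : ∀ a b → a ℤ.- b ≡ ℤ.- (b ℤ.- a)
  negate = solve-∀

  p-anti : ∀ {T} → IsStandard T → IsStandard (swapEntries (suc k) T) → p (swapEntries (suc k) T) ≡ ℤ.- p T
  p-anti {T} std std′ = trans
    (cong₂ ℤ._-_ (cong₂ lt (moved i₁ i₂ (transpose-fst i₁ i₂)) x′)
                 (cong₂ lt (moved i₂ i₁ (transpose-snd i₁ i₂)) x′))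
    (negate (lt (z T) (x T)) (lt (y T) (x T)))
    where
    moved : ∀ a b → transpose i₁ i₂ a ≡ b → contentAt (swapEntries (suc k) T) a ≡ contentAt T b
    moved a b e = trans (contentAt-swap (suc k) std std′ a) (cong (contentAt T) e)
    x′ : x (swapEntries (suc k) T) ≡ x T
    x′ = moved i₀ i₀ (transpose-other i₁ i₂ (Fin.<⇒≢ i₀<i₁) i₀≢i₂)

  q-anti : ∀ {T} → IsStandard T → IsStandard (swapEntries (inject₁ k) T) → q (swapEntries (inject₁ k) T) ≡ ℤ.- q T
  q-anti {T} std std′ = trans
    (cong₂ ℤ._-_ (cong₂ lt (moved i₁ i₀ (transpose-snd i₀ i₁)) z′)
                 (cong₂ lt (moved i₀ i₁ (transpose-fst i₀ i₁)) z′))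
    (negate (lt (x T) (z T)) (lt (y T) (z T)))
    where
    moved : ∀ a b → transpose i₀ i₁ a ≡ b → contentAt (swapEntries (inject₁ k) T) a ≡ contentAt T b
    moved a b e = trans (contentAt-swap (inject₁ k) std std′ a) (cong (contentAt T) e)
    z′ : z (swapEntries (inject₁ k) T) ≡ z T
    z′ = moved i₂ i₂ (transpose-other i₀ i₁ (i₀≢i₂ ∘ sym) (Fin.<⇒≢ i₁<i₂ ∘ sym))

  p-fixed : ∀ {T} → IsStandard T → z T ≡ 1ℤ ℤ.+ y T ⊎ y T ≡ 1ℤ ℤ.+ z T → p T ≡ 0ℤ
  p-fixed {T} std (inj₁ e) = ℤ.i≡j⇒i-j≡0 (sym (trans (cong (λ t → lt t (x T)) e)
    (lt-sucˡ (y T) (x T) (λ e′ → x≢z std (sym (trans e e′))))))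
  p-fixed {T} std (inj₂ e) = ℤ.i≡j⇒i-j≡0 (trans (cong (λ t → lt t (x T)) e)
    (lt-sucˡ (z T) (x T) (λ e′ → x≢y std (sym (trans e e′)))))

  q-fixed : ∀ {T} → IsStandard T → y T ≡ 1ℤ ℤ.+ x T ⊎ x T ≡ 1ℤ ℤ.+ y T → q T ≡ 0ℤ
  q-fixed {T} std (inj₁ e) = ℤ.i≡j⇒i-j≡0 (trans (cong (λ t → lt t (z T)) e)
    (lt-sucˡ (x T) (z T) (λ e′ → y≢z std (trans e e′))))
  q-fixed {T} std (inj₂ e) = ℤ.i≡j⇒i-j≡0 (sym (trans (cong (λ t → lt t (z T)) e)
    (lt-sucˡ (y T) (z T) (λ e′ → x≢z std (trans e e′)))))

-- Binomial coefficients as sums of initial segments.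

length-as-∑ : ∀ (xs : List A) → length xs ≡ ∑ℕ.∑ xs (λ _ → 1)
length-as-∑ []       = refl
length-as-∑ (x ∷ xs) = cong suc (length-as-∑ xs)

∑-toℕ : ∀ n → ∑ℕ.∑ (allFin n) toℕ ≡ n C 2
∑-toℕ zero    = refl
∑-toℕ (suc n) = begin
  ∑ℕ.∑ (allFin (suc n)) toℕ                             ≡⟨ allFin-suc ⟩
  ∑ℕ.∑ (allFin n) (λ k → 1 ℕ.+ toℕ k)                   ≡⟨ ∑ℕ.∑-distrib (allFin n) (λ _ → 1) toℕ ⟩
  ∑ℕ.∑ (allFin n) (λ _ → 1) ℕ.+ ∑ℕ.∑ (allFin n) toℕ     ≡⟨ cong₂ ℕ._+_ ones (∑-toℕ n) ⟩
  n C 1 ℕ.+ n C 2                                       ≡⟨ nCk+nC[k+1]≡[n+1]C[k+1] n 1 ⟩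
  suc n C 2                                             ∎
  where
  open ≡-Reasoning
  allFin-suc : ∑ℕ.∑ (allFin (suc n)) toℕ ≡ ∑ℕ.∑ (allFin n) (λ k → 1 ℕ.+ toℕ k)
  allFin-suc = trans {j = ∑ℕ.∑ (map suc (allFin n)) toℕ} (cong (λ ks → ∑ℕ.∑ ks toℕ) (sym (map-tabulate {n = n} (λ k → k) suc)))
                     (∑ℕ.∑-map suc (allFin n) toℕ)
  ones : ∑ℕ.∑ (allFin n) (λ _ → 1) ≡ n C 1
  ones = trans (sym (length-as-∑ (allFin n))) (trans (length-tabulate (λ k → k)) (sym (nC1≡n n)))

2*[nC2] : ∀ n → 2 ℕ.* (n C 2) ≡ n ℕ.* (n ∸ 1)
2*[nC2] zero          = refl
2*[nC2] (suc zero)    = refl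
2*[nC2] (suc (suc n)) = begin
  2 ℕ.* (suc (suc n) C 2)                       ≡⟨ cong (2 ℕ.*_) (nCk+nC[k+1]≡[n+1]C[k+1] (suc n) 1) ⟨
  2 ℕ.* (suc n C 1 ℕ.+ suc n C 2)               ≡⟨ ℕ.*-distribˡ-+ 2 (suc n C 1) (suc n C 2) ⟩
  2 ℕ.* (suc n C 1) ℕ.+ 2 ℕ.* (suc n C 2)       ≡⟨ cong₂ (λ a b → 2 ℕ.* a ℕ.+ b) (nC1≡n (suc n)) (2*[nC2] (suc n)) ⟩
  2 ℕ.* suc n ℕ.+ suc n ℕ.* n                   ≡⟨ arith n ⟩
  suc (suc n) ℕ.* suc n                         ∎
  where
  open ≡-Reasoning
  arith : ∀ n → 2 ℕ.* suc n ℕ.+ suc n ℕ.* n ≡ suc (suc n) ℕ.* suc n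
  arith = ℕ-solve-∀

-- Summing the rows and columns of the cells of a diagram

length-cells : ∀ ps → length (cells ps) ≡ sum ps
length-cells []       = refl
length-cells (p ∷ ps) = begin
  length (map (cell zero) (allFin p) ++ map below (cells ps))
    ≡⟨ length-++ (map (cell zero) (allFin p)) ⟩
  length (map (cell zero) (allFin p)) ℕ.+ length (map below (cells ps))
    ≡⟨ cong₂ ℕ._+_ (trans (length-map (cell zero) (allFin p)) (length-tabulate (λ x → x)))
                   (trans (length-map below (cells ps)) (length-cells ps)) ⟩
  p ℕ.+ sum ps ∎
  where open ≡-Reasoning

∑-cells : ∀ p ps (g : Cell (p ∷ ps) → ℕ) →
          ∑ℕ.∑ (cells (p ∷ ps)) g ≡ ∑ℕ.∑ (allFin p) (g ∘ cell zero) ℕ.+ ∑ℕ.∑ (cells ps) (g ∘ below)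
∑-cells p ps g = trans (∑ℕ.∑-++ (map (cell zero) (allFin p)) (map below (cells ps)) g)
  (cong₂ ℕ._+_ (∑ℕ.∑-map (cell zero) (allFin p) g) (∑ℕ.∑-map below (cells ps) g))

∑-col : ∀ ps → ∑ℕ.∑ (cells ps) col ≡ sum (map (_C 2) ps)
∑-col []       = refl
∑-col (p ∷ ps) = trans (∑-cells p ps col) (cong₂ ℕ._+_ (∑-toℕ p) (∑-col ps))

-- A new top row pushes every other cell down by one and itself contributes nothing.
∑-row-∷ : ∀ p ps → ∑ℕ.∑ (cells (p ∷ ps)) row ≡ sum ps ℕ.+ ∑ℕ.∑ (cells ps) row
∑-row-∷ p ps = begin
  ∑ℕ.∑ (cells (p ∷ ps)) row
    ≡⟨ ∑-cells p ps row ⟩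
  ∑ℕ.∑ (allFin p) (λ _ → 0) ℕ.+ ∑ℕ.∑ (cells ps) (λ c → 1 ℕ.+ row c)
    ≡⟨ cong₂ ℕ._+_ (∑ℕ.∑-zero (allFin p)) (∑ℕ.∑-distrib (cells ps) (λ _ → 1) row) ⟩
  ∑ℕ.∑ (cells ps) (λ _ → 1) ℕ.+ ∑ℕ.∑ (cells ps) row
    ≡⟨ cong (ℕ._+ ∑ℕ.∑ (cells ps) row) (trans (sym (length-as-∑ (cells ps))) (length-cells ps)) ⟩
  sum ps ℕ.+ ∑ℕ.∑ (cells ps) row ∎
  where open ≡-Reasoning

column : List ℕ → ℕ → ℕ
column ps j = length (filter (j ℕ.<?_) ps)

column-empty : ∀ {ps j} → All (ℕ._≤ j) ps → column ps j ≡ 0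
column-empty {j = j} ps≤j = cong length (filter-none (j ℕ.<?_) (All.map ℕ.≤⇒≯ ps≤j))

∑-column : ∀ L ps → largest ps ℕ.≤ L → ∑ℕ.∑ (upTo L) (column ps) ≡ sum ps
∑-column L []       _   = ∑ℕ.∑-zero (upTo L)
∑-column L (p ∷ ps) p≤L = begin
  ∑ℕ.∑ (upTo L) (column (p ∷ ps))
    ≡⟨ ∑ℕ.∑-cong (upTo L) (λ {j} _ → column-∷ j) ⟩
  ∑ℕ.∑ (upTo L) (λ j → (if does (j ℕ.<? p) then 1 else 0) ℕ.+ column ps j)
    ≡⟨ ∑ℕ.∑-distrib (upTo L) (λ j → if does (j ℕ.<? p) then 1 else 0) (column ps) ⟩
  ∑ℕ.∑ (upTo L) (λ j → if does (j ℕ.<? p) then 1 else 0) ℕ.+ ∑ℕ.∑ (upTo L) (column ps)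
    ≡⟨ cong₂ ℕ._+_ (count-below p L (ℕ.m⊔n≤o⇒m≤o p (largest ps) p≤L))
                   (∑-column L ps (ℕ.m⊔n≤o⇒n≤o p (largest ps) p≤L)) ⟩
  p ℕ.+ sum ps ∎
  where
  open ≡-Reasoning
  column-∷ : ∀ j → column (p ∷ ps) j ≡ (if does (j ℕ.<? p) then 1 else 0) ℕ.+ column ps j
  column-∷ j with does (j ℕ.<? p)
  ... | true  = refl
  ... | false = refl
  count-below : ∀ p L → p ℕ.≤ L → ∑ℕ.∑ (upTo L) (λ j → if does (j ℕ.<? p) then 1 else 0) ≡ p
  count-below zero    L       _           = ∑ℕ.∑-zero (upTo L)
  count-below (suc p) (suc L) (ℕ.s≤s p≤L) = cong suc (begin
    ∑ℕ.∑ (applyUpTo suc L) (λ j → if does (j ℕ.<? suc p) then 1 else 0)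
      ≡⟨ cong (λ xs → ∑ℕ.∑ xs (λ j → if does (j ℕ.<? suc p) then 1 else 0)) (map-upTo suc L) ⟨
    ∑ℕ.∑ (map suc (upTo L)) (λ j → if does (j ℕ.<? suc p) then 1 else 0)
      ≡⟨ ∑ℕ.∑-map suc (upTo L) _ ⟩
    ∑ℕ.∑ (upTo L) (λ j → if does (j ℕ.<? p) then 1 else 0)
      ≡⟨ count-below p L p≤L ⟩
    p ∎)

-- Induction on rows: a longest row placed on top lengthens each nonempty column by one, and
-- C(s+1,2) = s + C(s,2). The bound `L` is kept apart from `largest ps` so that the range of columns
-- stays fixed in the induction.
∑-row : ∀ L {ps} → AllPairs ℕ._≥_ ps → largest ps ℕ.≤ L →
        ∑ℕ.∑ (upTo L) (λ j → column ps j C 2) ≡ ∑ℕ.∑ (cells ps) row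
∑-row L {[]}     _        _   = ∑ℕ.∑-zero (upTo L)
∑-row L {p ∷ ps} (p≥ ∷ ap) p≤L = begin
  ∑ℕ.∑ (upTo L) (λ j → column (p ∷ ps) j C 2)
    ≡⟨ ∑ℕ.∑-cong (upTo L) (λ {j} _ → column-∷-C2 j) ⟩
  ∑ℕ.∑ (upTo L) (λ j → column ps j ℕ.+ column ps j C 2)
    ≡⟨ ∑ℕ.∑-distrib (upTo L) (column ps) (λ j → column ps j C 2) ⟩
  ∑ℕ.∑ (upTo L) (column ps) ℕ.+ ∑ℕ.∑ (upTo L) (λ j → column ps j C 2)
    ≡⟨ cong₂ ℕ._+_ (∑-column L ps ps≤L) (∑-row L ap ps≤L) ⟩
  sum ps ℕ.+ ∑ℕ.∑ (cells ps) row
    ≡⟨ ∑-row-∷ p ps ⟨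
  ∑ℕ.∑ (cells (p ∷ ps)) row ∎
  where
  open ≡-Reasoning
  ps≤L : largest ps ℕ.≤ L
  ps≤L = ℕ.m⊔n≤o⇒n≤o p (largest ps) p≤L
  column-∷-C2 : ∀ j → column (p ∷ ps) j C 2 ≡ column ps j ℕ.+ column ps j C 2
  column-∷-C2 j = case j ℕ.<? p of λ where
    (yes j<p) → begin
      column (p ∷ ps) j C 2                    ≡⟨ cong (λ xs → length xs C 2) (filter-accept (j ℕ.<?_) j<p) ⟩
      suc (column ps j) C 2                    ≡⟨ nCk+nC[k+1]≡[n+1]C[k+1] (column ps j) 1 ⟨
      column ps j C 1 ℕ.+ column ps j C 2      ≡⟨ cong (ℕ._+ column ps j C 2) (nC1≡n (column ps j)) ⟩
      column ps j ℕ.+ column ps j C 2          ∎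
    -- Beyond the top row every column is empty, as the rows below are no longer; the added summand
    -- is 0.
    (no j≮p) → begin
      column (p ∷ ps) j C 2                    ≡⟨ cong (λ xs → length xs C 2) (filter-reject (j ℕ.<?_) j≮p) ⟩
      column ps j C 2                          ≡⟨ cong (ℕ._+ column ps j C 2) (column-empty (All.map (λ q≤p → ℕ.≤-trans q≤p (ℕ.≮⇒≥ j≮p)) p≥)) ⟨
      column ps j ℕ.+ column ps j C 2          ∎

∑-conjugate : ∀ {ps} → Linked ℕ._≥_ ps → sum (map (_C 2) (conjugate ps)) ≡ ∑ℕ.∑ (cells ps) row
∑-conjugate {ps} decr = trans
  (∑ℕ.∑-map (column ps) (upTo (largest ps)) (_C 2))
  (∑-row (largest ps) (Linked⇒AllPairs (λ x≥y y≥z → ℕ.≤-trans y≥z x≥y) decr) ℕ.≤-refl)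

∑-content : ∀ ps → ∑ (cells ps) content ℤ.+ + ∑ℕ.∑ (cells ps) row ≡ + ∑ℕ.∑ (cells ps) col
∑-content ps = begin
  ∑ (cells ps) content ℤ.+ + ∑ℕ.∑ (cells ps) row
    ≡⟨ cong (ℤ._+_ (∑ (cells ps) content)) (∑-pos (cells ps) row) ⟨
  ∑ (cells ps) content ℤ.+ ∑ (cells ps) (λ c → + row c)
    ≡⟨ ∑ℤ.∑-distrib (cells ps) content (λ c → + row c) ⟨
  ∑ (cells ps) (λ c → content c ℤ.+ + row c)
    ≡⟨ ∑ℤ.∑-cong (cells ps) (λ {c} _ → cancel (+ col c) (+ row c)) ⟩
  ∑ (cells ps) (λ c → + col c)
    ≡⟨ ∑-pos (cells ps) col ⟩
  + ∑ℕ.∑ (cells ps) col ∎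
  where
  open ≡-Reasoning
  cancel : ∀ a b → (a ℤ.- b) ℤ.+ b ≡ a
  cancel = solve-∀

-- Total content and the common descent count.

module _ {T : Filling n ps} (std : IsStandard T) where
  open IsStandard std

  -- Since `entry T` is a bijection, summing over entries is summing over cells, and the total is
  -- the same for every tableau.
  ∑-contentAt : ∑ (allFin n) (contentAt T) ≡ ∑ (cells ps) content
  ∑-contentAt = begin
    ∑ (allFin n) (contentAt T)                       ≡⟨ ∑ℤ.∑-↭ (contentAt T) entries ⟩
    ∑ (map (entry T) (cells ps)) (contentAt T)       ≡⟨ ∑ℤ.∑-map (entry T) (cells ps) (contentAt T) ⟩
    ∑ (cells ps) (contentAt T ∘ entry T)             ≡⟨ ∑ℤ.∑-cong (cells ps) (λ _ → contentAt-entry std refl) ⟩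
    ∑ (cells ps) content                             ∎
    where
    open ≡-Reasoning
    entries : allFin n ↭ map (entry T) (cells ps)
    entries = ↭-of-unique (Unique.allFin⁺ n) (Unique.map⁺ (proj₁ eachOnce) (cells-unique ps))
      (λ {k} _ → let c , e = cellAt std k in
        subst (_∈ map (entry T) (cells ps)) e (∈-map⁺ (entry T) (∈-cells c)))
      (λ {k} _ → ∈-allFin k)

-- The corner is weakly northwest of the cell with the smallest entry, so it holds that entry
-- itself.
contentAt-zero : {T : Filling (suc n) ps} → Linked ℕ._≥_ ps → IsStandard T → contentAt T zero ≡ 0ℤ
contentAt-zero {T = T} decr std with cellAt std zero
... | c , e with order-ideal decr c ℕ.z≤n ℕ.z≤n
...   | d , dr , dc = trans (contentAt-entry std d≡0) (cong₂ (λ x y → + x ℤ.- + y) dc dr)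
  where
  d≤c : label T d ℕ.≤ label T c
  d≤c = label-mono decr std (subst (ℕ._≤ row c) (sym dr) ℕ.z≤n) (subst (ℕ._≤ col c) (sym dc) ℕ.z≤n)
  d≡0 : entry T d ≡ zero
  d≡0 = Fin.toℕ-injective (ℕ.n≤0⇒n≡0 (ℕ.≤-trans (ℕ.s≤s⁻¹ d≤c) (ℕ.≤-reflexive (cong toℕ e))))

module _ {m} (Λ : Partition (suc (suc m))) where

  private
    tabs : List (Filling (suc (suc m)) (parts Λ))
    tabs = standardTableaux Λ

    Δ F K : ℤ
    Δ = + descentCount tabs 1
    F = + tableauCount Λ
    K = ∑ (cells (parts Λ)) content

  descentCount-constant : ∀ (k : Fin (suc m)) → descentCount tabs (suc (toℕ k)) ≡ descentCount tabs 1
  descentCount-constant = <-weakInduction (λ k → descentCount tabs (suc (toℕ k)) ≡ descentCount tabs 1) refl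
    λ k ih → trans (sym (descentCount-step Λ k)) ih

  contentSum-linear : ∀ k → contentSum Λ k ≡ + toℕ k ℤ.* (F ℤ.- (Δ ℤ.+ Δ))
  contentSum-linear = <-weakInduction (λ k → contentSum Λ k ≡ + toℕ k ℤ.* (F ℤ.- (Δ ℤ.+ Δ))) base step
    where
    open ≡-Reasoning
    base : contentSum Λ zero ≡ 0ℤ
    base = trans (∑ℤ.∑-cong tabs (λ T∈ → contentAt-zero (decreasing Λ) (∈-standardTableaux⁻ Λ T∈)))
                 (∑ℤ.∑-zero tabs)
    shift : ∀ a d → a ≡ (a ℤ.+ (d ℤ.+ d)) ℤ.- (d ℤ.+ d)
    shift = solve-∀
    arith : ∀ k f d → (k ℤ.* (f ℤ.- (d ℤ.+ d)) ℤ.+ f) ℤ.- (d ℤ.+ d) ≡ (1ℤ ℤ.+ k) ℤ.* (f ℤ.- (d ℤ.+ d))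
    arith = solve-∀
    step : ∀ k → contentSum Λ (inject₁ k) ≡ + toℕ (inject₁ k) ℤ.* (F ℤ.- (Δ ℤ.+ Δ)) →
           contentSum Λ (suc k) ≡ + suc (toℕ k) ℤ.* (F ℤ.- (Δ ℤ.+ Δ))
    step k ih = begin
      contentSum Λ (suc k)
        ≡⟨ shift (contentSum Λ (suc k)) Δ ⟩
      (contentSum Λ (suc k) ℤ.+ (Δ ℤ.+ Δ)) ℤ.- (Δ ℤ.+ Δ)
        ≡⟨ cong (λ d → (contentSum Λ (suc k) ℤ.+ (+ d ℤ.+ + d)) ℤ.- (Δ ℤ.+ Δ)) (descentCount-constant k) ⟨
      (contentSum Λ (suc k) ℤ.+ (+ descentCount tabs (suc (toℕ k)) ℤ.+ + descentCount tabs (suc (toℕ k)))) ℤ.- (Δ ℤ.+ Δ)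
        ≡⟨ cong (ℤ._- (Δ ℤ.+ Δ)) (contentSum-step Λ k) ⟩
      (contentSum Λ (inject₁ k) ℤ.+ F) ℤ.- (Δ ℤ.+ Δ)
        ≡⟨ cong (λ a → (a ℤ.+ F) ℤ.- (Δ ℤ.+ Δ)) (trans ih (cong (λ j → + j ℤ.* (F ℤ.- (Δ ℤ.+ Δ))) (Fin.toℕ-inject₁ k))) ⟩
      (+ toℕ k ℤ.* (F ℤ.- (Δ ℤ.+ Δ)) ℤ.+ F) ℤ.- (Δ ℤ.+ Δ)
        ≡⟨ arith (+ toℕ k) F Δ ⟩
      + suc (toℕ k) ℤ.* (F ℤ.- (Δ ℤ.+ Δ)) ∎

  total-content : F ℤ.* K ≡ + (suc (suc m) C 2) ℤ.* (F ℤ.- (Δ ℤ.+ Δ))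
  total-content = begin
    F ℤ.* K
      ≡⟨ trans (∑ℤ.∑-const tabs K) (·ⁿ-* (length tabs) K) ⟨
    ∑ tabs (λ _ → K)
      ≡⟨ ∑ℤ.∑-cong tabs (λ T∈ → ∑-contentAt (∈-standardTableaux⁻ Λ T∈)) ⟨
    ∑ tabs (λ T → ∑ (allFin (suc (suc m))) (contentAt T))
      ≡⟨ ∑ℤ.∑-exchange tabs (allFin (suc (suc m))) contentAt ⟩
    ∑ (allFin (suc (suc m))) (contentSum Λ)
      ≡⟨ ∑ℤ.∑-cong (allFin (suc (suc m))) (λ {k} _ → contentSum-linear k) ⟩
    ∑ (allFin (suc (suc m))) (λ k → + toℕ k ℤ.* (F ℤ.- (Δ ℤ.+ Δ)))
      ≡⟨ ∑-*ʳ (allFin (suc (suc m))) (λ k → + toℕ k) (F ℤ.- (Δ ℤ.+ Δ)) ⟩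
    ∑ (allFin (suc (suc m))) (λ k → + toℕ k) ℤ.* (F ℤ.- (Δ ℤ.+ Δ))
      ≡⟨ cong (ℤ._* (F ℤ.- (Δ ℤ.+ Δ))) (trans (∑-pos (allFin (suc (suc m))) toℕ) (cong +_ (∑-toℕ (suc (suc m))))) ⟩
    + (suc (suc m) C 2) ℤ.* (F ℤ.- (Δ ℤ.+ Δ)) ∎
    where open ≡-Reasoning

  numerator : ℤ
  numerator = (+ (suc (suc m) C 2) ℤ.- + sum (map (_C 2) (parts Λ)))
                ℤ.+ + sum (map (_C 2) (conjugate (parts Λ)))

  -- The cross-multiplied form of Δ / F = c(λ), kept in ℤ until the count of tableaux is known to be
  -- positive.
  descentCount-formula : Δ ℤ.* + (suc (suc m) ℕ.* suc m) ≡ numerator ℤ.* F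
  descentCount-formula = begin
    Δ ℤ.* + (suc (suc m) ℕ.* suc m)        ≡⟨ cong (λ a → Δ ℤ.* + a) (2*[nC2] (suc (suc m))) ⟨
    Δ ℤ.* + (2 ℕ.* N)                      ≡⟨ cong (Δ ℤ.*_) (ℤ.pos-* 2 N) ⟩
    Δ ℤ.* (+ 2 ℤ.* + N)                    ≡⟨ isolate (+ N) F Δ ⟩
    + N ℤ.* F ℤ.- + N ℤ.* (F ℤ.- (Δ ℤ.+ Δ)) ≡⟨ cong (λ a → (+ N ℤ.* F) ℤ.- a) total-content ⟨
    -- The sum `R` of the row indices is inserted and removed again, so that `K ℤ.+ R`, the sum of
    -- the column indices, appears.
    + N ℤ.* F ℤ.- F ℤ.* K                  ≡⟨ regroup (+ N) F K R ⟩
    ((+ N ℤ.- (K ℤ.+ R)) ℤ.+ R) ℤ.* F      ≡⟨ cong (λ a → ((+ N ℤ.- a) ℤ.+ R) ℤ.* F) (∑-content (parts Λ)) ⟩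
    ((+ N ℤ.- + ∑ℕ.∑ (cells (parts Λ)) col) ℤ.+ R) ℤ.* F
      ≡⟨ cong₂ (λ a b → ((+ N ℤ.- + a) ℤ.+ + b) ℤ.* F) (∑-col (parts Λ)) (sym (∑-conjugate (decreasing Λ))) ⟩
    numerator ℤ.* F                        ∎
    where
    open ≡-Reasoning
    N : ℕ
    N = suc (suc m) C 2
    R : ℤ
    R = + ∑ℕ.∑ (cells (parts Λ)) row
    isolate : ∀ n f d → d ℤ.* (+ 2 ℤ.* n) ≡ n ℤ.* f ℤ.- n ℤ.* (f ℤ.- (d ℤ.+ d))
    isolate = solve-∀
    regroup : ∀ n f k r → n ℤ.* f ℤ.- f ℤ.* k ≡ ((n ℤ.- (k ℤ.+ r)) ℤ.+ r) ℤ.* f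
    regroup = solve-∀

-- Existence of standard tableaux: fill the rows one after the other

fill : ∀ {A : Set} ps → (Cell ps → A) → All (Vec A) ps
fill []       e = []
fill (p ∷ ps) e = Vec.tabulate (e ∘ cell zero) ∷ fill ps (e ∘ below)

entry-fill : ∀ ps (e : Cell ps → Fin n) c → entry (fill ps e) c ≡ e c
entry-fill (p ∷ ps) e (cell zero j)    = Vec.lookup∘tabulate (e ∘ cell zero) j
entry-fill (p ∷ ps) e (cell (suc i) j) = entry-fill ps (e ∘ below) (cell i j)

-- The rank in row reading order; filling by it gives the row superstandard tableau. Every row is
-- exhausted before the next begins, so columns increase as well.
position : ∀ ps → Cell ps → Fin (sum ps)
position (p ∷ ps) (cell zero j)    = j ↑ˡ sum ps
position (p ∷ ps) (cell (suc i) j) = p ↑ʳ position ps (cell i j)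

position-<-row : ∀ ps c d → row c ℕ.< row d → position ps c Fin.< position ps d
position-<-row (p ∷ ps) (cell zero j) (cell (suc i′) j′) _ =
  subst₂ ℕ._<_ (sym (Fin.toℕ-↑ˡ j (sum ps))) (sym (Fin.toℕ-↑ʳ p (position ps (cell i′ j′))))
    (ℕ.<-≤-trans (Fin.toℕ<n j) (ℕ.m≤m+n p _))
position-<-row (p ∷ ps) (cell (suc i) j) (cell (suc i′) j′) (ℕ.s≤s r) =
  subst₂ ℕ._<_ (sym (Fin.toℕ-↑ʳ p (position ps (cell i j)))) (sym (Fin.toℕ-↑ʳ p (position ps (cell i′ j′))))
    (ℕ.+-monoʳ-< p (position-<-row ps (cell i j) (cell i′ j′) r))

position-<-col : ∀ ps c d → row c ≡ row d → col c ℕ.< col d → position ps c Fin.< position ps d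
position-<-col (p ∷ ps) (cell zero j) (cell zero j′) _ s =
  subst₂ ℕ._<_ (sym (Fin.toℕ-↑ˡ j (sum ps))) (sym (Fin.toℕ-↑ˡ j′ (sum ps))) s
position-<-col (p ∷ ps) (cell (suc i) j) (cell (suc i′) j′) r s =
  subst₂ ℕ._<_ (sym (Fin.toℕ-↑ʳ p (position ps (cell i j)))) (sym (Fin.toℕ-↑ʳ p (position ps (cell i′ j′))))
    (ℕ.+-monoʳ-< p (position-<-col ps (cell i j) (cell i′ j′) (ℕ.suc-injective r) s))

position-injective : ∀ ps {c d} → position ps c ≡ position ps d → c ≡ d
position-injective ps {c} {d} e with ℕ.<-cmp (row c) (row d)
... | tri< r _ _ = contradiction e (Fin.<⇒≢ (position-<-row ps c d r))
... | tri> _ _ r = contradiction (sym e) (Fin.<⇒≢ (position-<-row ps d c r))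
... | tri≈ _ r _ with ℕ.<-cmp (col c) (col d)
...   | tri< s _ _ = contradiction e (Fin.<⇒≢ (position-<-col ps c d r s))
...   | tri≈ _ s _ = cell-≡ r s
...   | tri> _ _ s = contradiction (sym e) (Fin.<⇒≢ (position-<-col ps d c (sym r) s))

position-surjective : ∀ ps k → ∃ λ c → position ps c ≡ k
position-surjective (p ∷ ps) k with splitAt p k in eq
... | inj₁ j = cell zero j , Fin.splitAt⁻¹-↑ˡ eq
... | inj₂ l with position-surjective ps l
...   | cell i j , e = cell (suc i) j , trans (cong (p ↑ʳ_) e) (Fin.splitAt⁻¹-↑ʳ eq)

rowFilling-standard : ∀ ps → IsStandard (fill ps (position ps))
rowFilling-standard ps = record
  { eachOnce    = (λ {c} {d} e → position-injective ps
                    (trans (sym (entry-fill ps (position ps) c)) (trans e (entry-fill ps (position ps) d)))) ,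
                  λ k → let c , e = position-surjective ps k in
                    c , λ { refl → trans (entry-fill ps (position ps) c) e }
  ; increasing→ = λ c d r s → ordered c d (position-<-col ps c d r s)
  ; increasing↓ = λ c d _ r → ordered c d (position-<-row ps c d r)
  }
  where
  ordered : ∀ c d → position ps c Fin.< position ps d →
            label (fill ps (position ps)) c ℕ.< label (fill ps (position ps)) d
  ordered c d c<d = ℕ.s≤s (subst₂ Fin._<_ (sym (entry-fill ps (position ps) c))
                                          (sym (entry-fill ps (position ps) d)) c<d)

-- This excludes the dummy branch of `mean` and makes the number of tableaux a valid denominator.
standardTableau : ∀ ps → sum ps ≡ n → ∃ λ (T : Filling n ps) → IsStandard T
standardTableau ps refl = fill ps (position ps) , rowFilling-standard ps

-- Rational arithmetic and the terms of real sequences.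

module ∑ℚ = ListSum ℚ.+-0-commutativeMonoid

-- Normalised fractions are images of unnormalised ones, where equality is cross-multiplication;
-- `ℚᵘ.mkℚᵘ` stores the denominator minus one.
/-cross : ∀ p q d e → p ℤ.* + suc e ≡ q ℤ.* + suc d → p ℚ./ suc d ≡ q ℚ./ suc e
/-cross p q d e eq = ℚ.fromℚᵘ-cong {ℚᵘ.mkℚᵘ p d} {ℚᵘ.mkℚᵘ q e} (ℚᵘ.*≡* eq)

/-+ : ∀ p q d → p ℚ./ suc d ℚ.+ q ℚ./ suc d ≡ (p ℤ.+ q) ℚ./ suc d
/-+ p q d = ℚ.toℚᵘ-injective (begin
  ℚ.toℚᵘ (p ℚ./ suc d ℚ.+ q ℚ./ suc d)                  ≈⟨ ℚ.toℚᵘ-homo-+ (p ℚ./ suc d) (q ℚ./ suc d) ⟩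
  ℚ.toℚᵘ (p ℚ./ suc d) ℚᵘ.+ ℚ.toℚᵘ (q ℚ./ suc d)        ≈⟨ ℚᵘ.+-cong (ℚ.toℚᵘ-fromℚᵘ (ℚᵘ.mkℚᵘ p d)) (ℚ.toℚᵘ-fromℚᵘ (ℚᵘ.mkℚᵘ q d)) ⟩
  -- Unnormalised addition multiplies the denominators, so the left side has denominator `suc d`
  -- squared.
  ℚᵘ.mkℚᵘ p d ℚᵘ.+ ℚᵘ.mkℚᵘ q d                          ≈⟨ ℚᵘ.*≡* (trans (distrib p q (+ suc d)) (cong ((p ℤ.+ q) ℤ.*_) (sym (ℤ.pos-* (suc d) (suc d))))) ⟩
  ℚᵘ.mkℚᵘ (p ℤ.+ q) d                                   ≈⟨ ℚ.toℚᵘ-fromℚᵘ (ℚᵘ.mkℚᵘ (p ℤ.+ q) d) ⟨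
  ℚ.toℚᵘ ((p ℤ.+ q) ℚ./ suc d)                          ∎)
  where
  open import Relation.Binary.Reasoning.Setoid ℚᵘ.≃-setoid
  distrib : ∀ p q e → (p ℤ.* e ℤ.+ q ℤ.* e) ℤ.* e ≡ (p ℤ.+ q) ℤ.* (e ℤ.* e)
  distrib = solve-∀

·ⁿ-/ : ∀ k d → k ∑ℚ.·ⁿ (+ 1 ℚ./ suc d) ≡ + k ℚ./ suc d
·ⁿ-/ zero    d = /-cross (+ 0) (+ 0) 0 d refl
·ⁿ-/ (suc k) d = trans (cong (+ 1 ℚ./ suc d ℚ.+_) (·ⁿ-/ k d)) (/-+ (+ 1) (+ k) d)

seq-sumℝ : ∀ (g : A → ℝ) xs t → seq (sumℝ (map g xs)) t ≡ ∑ℚ.∑ xs (λ x → seq (g x) t)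
seq-sumℝ g []       t = refl
seq-sumℝ g (x ∷ xs) t = cong (ℚ._+_ (seq (g x) t)) (seq-sumℝ g xs t)

seq-mean : ∀ (g : A → ℝ) xs {l} t → length xs ≡ suc l →
           seq (mean (map g xs)) t ≡ (+ 1 ℚ./ suc l) ℚ.* ∑ℚ.∑ xs (λ x → seq (g x) t)
seq-mean g (x ∷ xs) t refl = cong₂ ℚ._*_
  (cong (λ l → + 1 ℚ./ suc l) (length-map g xs)) (seq-sumℝ g (x ∷ xs) t)

∈⇒length-suc : ∀ {x : A} {xs} → x ∈ xs → ∃ λ l → length xs ≡ suc l
∈⇒length-suc {xs = _ ∷ xs} _ = length xs , refl

∣p-p∣<ε : ∀ {p q ε} → p ≡ q → 0ℚ ℚ.< ε → ℚ.∣ p ℚ.- q ∣ ℚ.< ε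
∣p-p∣<ε {p} {ε = ε} refl = subst (ℚ._< ε) (cong ℚ.∣_∣ (sym (ℚ.+-inverseʳ p)))

-- The pairs of a tableau and one of its descents are grouped by the descent.
∑-descentFunction : ∀ (Ts : List (Filling n ps)) f t →
  ∑ℚ.∑ Ts (λ T → seq (descentFunction f T) t) ≡
  ∑ℚ.∑ [1‥ n ∸ 1 ] (λ i → descentCount Ts i ∑ℚ.·ⁿ seq (f i) t)
∑-descentFunction {n} Ts f t = trans
  (∑ℚ.∑-cong Ts (λ {T} _ → seq-sumℝ f (descents T) t))
  (∑ℚ.∑-filter-exchange {P = IsDescent} isDescent? Ts [1‥ n ∸ 1 ] (λ i → seq (f i) t))

module _ {m} (Λ : Partition (suc (suc m))) (f : ℕ → ℝ) (t : ℕ) where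

  private
    tabs : List (Filling (suc (suc m)) (parts Λ))
    tabs = standardTableaux Λ
    Δ : ℕ
    Δ = descentCount tabs 1
    S : ℚ
    S = ∑ℚ.∑ [1‥ suc m ] (λ i → seq (f i) t)

  descentCount-at : ∀ {i} → (∃ λ k → k ℕ.< suc m × i ≡ suc k) → descentCount tabs i ≡ Δ
  descentCount-at (k , k<m , refl) = trans (cong (descentCount tabs ∘ suc) (sym (Fin.toℕ-fromℕ< k<m)))
                                           (descentCount-constant Λ (fromℕ< k<m))

  descentCount-·ⁿ : ∀ {i} → i ∈ [1‥ suc m ] →
                    descentCount tabs i ∑ℚ.·ⁿ seq (f i) t ≡ Δ ∑ℚ.·ⁿ seq (f i) t
  descentCount-·ⁿ {i} i∈ = cong (λ d → d ∑ℚ.·ⁿ seq (f i) t) (descentCount-at (∈-applyUpTo⁻ suc i∈))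

  ∑-descentCount : ∑ℚ.∑ [1‥ suc m ] (λ i → descentCount tabs i ∑ℚ.·ⁿ seq (f i) t) ≡ Δ ∑ℚ.·ⁿ S
  ∑-descentCount = trans (∑ℚ.∑-cong [1‥ suc m ] descentCount-·ⁿ)
                         (∑ℚ.∑-·ⁿ Δ [1‥ suc m ] (λ i → seq (f i) t))

  seq-expectation : seq (expectation Λ (descentFunction f)) t ≡
                    seq (coefficient Λ · sumℝ (map f [1‥ suc m ])) t
  seq-expectation = begin
    seq (expectation Λ (descentFunction f)) t
      ≡⟨ seq-mean (descentFunction f) tabs t count ⟩
    (+ 1 ℚ./ suc l) ℚ.* ∑ℚ.∑ tabs (λ T → seq (descentFunction f T) t)
      ≡⟨ cong ((+ 1 ℚ./ suc l) ℚ.*_) (trans (∑-descentFunction tabs f t) ∑-descentCount) ⟩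
    (+ 1 ℚ./ suc l) ℚ.* (Δ ∑ℚ.·ⁿ S)
      ≡⟨ ×-comm-* Δ (+ 1 ℚ./ suc l) S ⟩
    Δ ∑ℚ.·ⁿ ((+ 1 ℚ./ suc l) ℚ.* S)
      ≡⟨ ×-assoc-* Δ (+ 1 ℚ./ suc l) S ⟨
    (Δ ∑ℚ.·ⁿ (+ 1 ℚ./ suc l)) ℚ.* S
      ≡⟨ cong (ℚ._* S) (·ⁿ-/ Δ l) ⟩
    (+ Δ ℚ./ suc l) ℚ.* S
      ≡⟨ cong₂ ℚ._*_ ratio (sym (seq-sumℝ f [1‥ suc m ] t)) ⟩
    seq (coefficient Λ · sumℝ (map f [1‥ suc m ])) t ∎
    where
    open ≡-Reasoning
    open import Algebra.Properties.Semiring.Mult (CommutativeRing.semiring ℚ.+-*-commutativeRing)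
      using (×-comm-*; ×-assoc-*)
    inhabited : ∃ λ l → length tabs ≡ suc l
    inhabited = ∈⇒length-suc (∈-standardTableaux⁺ Λ (proj₂ (standardTableau (parts Λ) (total Λ))))
    l : ℕ
    l = proj₁ inhabited
    count : length tabs ≡ suc l
    count = proj₂ inhabited
    ratio : + Δ ℚ./ suc l ≡ coefficient Λ
    -- The last argument is the predecessor of (m + 2)(m + 1), the denominator of `coefficient Λ`.
    ratio = /-cross (+ Δ) (numerator Λ) l (m ℕ.+ suc m ℕ.* suc m)
      (trans (descentCount-formula Λ) (cong (λ a → numerator Λ ℤ.* + a) count))

theorem1 : ∀ (n : ℕ) .{{_ : NonTrivial n}} (Λ : Partition n) (f : ℕ → ℝ) →
    expectation Λ (descentFunction f) ≈ coefficient Λ · sumℝ (map f [1‥ n ∸ 1 ])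
theorem1 zero          Λ f with () ← ℕ.nonTrivial⇒n>1 0
theorem1 (suc zero)    Λ f with ℕ.s≤s () ← ℕ.nonTrivial⇒n>1 1
-- The two sequences agree in every term, so the threshold 0 serves for each `ε`.
theorem1 (suc (suc m)) Λ f ε 0<ε = 0 , λ t _ → ∣p-p∣<ε (seq-expectation Λ f t) 0<ε
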